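{- For any $A,B,B',C,C'\in\widehat{\mathbb{F}_q}$ and any $x\in\mathbb{F}_q\setminus\{1\}$, $$F_{2}(A;B,B';C,C';x,1-x)=CB'C'(-1)\,\overline{A}(1-x)\;{}_{3}F_2\left(\begin{matrix}A,\overline{B}C,A\overline{C'}\\ C,AB'\overline{C'}\end{matrix}\bigg|\,-\frac{x}{1-x}\right).$$
   Context: Let $q$ be a power of a prime, $\mathbb{F}_q$ the field with $q$ elements, and $\widehat{\mathbb{F}_q}$ the group of (complex-valued) multiplicative characters of $\mathbb{F}_q^*$. Every character $\chi$, including the trivial character $\varepsilon$, is extended to $\mathbb{F}_q$ by $\chi(0)=0$. $\overline{\chi}$ denotes the inverse of $\chi$. Products of characters are evaluated pointwise, e.g. $CB'C'(-1)=C(-1)B'(-1)C'(-1)$. Jacobi sum: $J(\chi,\lambda)=\sum_{u\in\mathbb{F}_q}\chi(u)\lambda(1-u)$. Binomial coefficient of characters: $\binom{A}{B}=B(-1)J(A,\overline{B})$. Finite field ${}_3F_2$: for $A_0,A_1,A_2,B_1,B_2\in\widehat{\mathbb{F}_q}$ and $x\in\mathbb{F}_q$, $${}_{3}F_2\left(\begin{matrix}A_0,A_1,A_2\\ B_1,B_2\end{matrix}\bigg|\,x\right)=\frac{1}{q-1}\sum_{\chi}\binom{A_0\chi}{\chi}\binom{A_1\chi}{B_1\chi}\binom{A_2\chi}{B_2\chi}\chi(x),$$ the sum being over all multiplicative characters $\chi$ of $\mathbb{F}_q$. The finite field Appell series $F_2$ is defined, for $A,B,B',C,C'\in\widehat{\mathbb{F}_q}$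 and $x,y\in\mathbb{F}_q$, by $$F_{2}(A;B,B';C,C';x,y)=\varepsilon(xy)\,BB'CC'(-1)\sum_{u,v\in\mathbb{F}_q}B(u)B'(v)\,\overline{B}C(1-u)\,\overline{B'}C'(1-v)\,\overline{A}(1-ux-vy).$$ -}

module Defs where

open import Level using (Level; _⊔_) renaming (suc to lsuc)
open import Algebra.Bundles using (CommutativeRing)
open import Algebra.Apartness.Bundles using (HeytingField; HeytingCommutativeRing)
open import Algebra.Morphism.Structures using (module MonoidMorphisms)
import Algebra.Apartness.Properties.HeytingCommutativeRing as HeytingProperties
import Algebra.Properties.CommutativeSemiring.Exp as Exponentiation
import Algebra.Properties.Semiring.Mult as Multiples
import Algebra.Properties.Semiring.Sum as Summation
import Algebra.Properties.Ring as RingProperties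
import Algebra.Solver.Ring.NaturalCoefficients.Default as SemiringSolver
open import Data.Fin.Base using (Fin; zero; suc; toℕ; finToFun; funToFin)
open import Data.Fin.Properties as Fin using (any?; pigeonhole; finToFun-funToFin)
open import Data.List.Base using (List; mapMaybe; allFin; deduplicate; lookup)
open import Data.List.Membership.Propositional.Properties using (∈-allFin)
import Data.List.Relation.Unary.Any as Any
import Data.List.Relation.Unary.Any.Properties as Any
open import Data.List.Relation.Unary.Enumerates.Setoid using (IsEnumeration)
open import Data.List.Relation.Unary.Enumerates.Setoid.Properties using (deduplicate⁺)
open import Data.List.Relation.Unary.Unique.DecSetoid.Properties using (deduplicate-!)
open import Data.List.Relation.Unary.Unique.Setoid using (Unique)
open import Data.Maybe.Base using (Maybe; just; nothing)
open import Data.Maybe.Relation.Unary.Any as MAny using (just)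
open import Data.Nat.Base as ℕ using (ℕ; zero; suc; _!)
open import Data.Nat.Divisibility using (_∣_; divides; ∣-trans; m≤n⇒m!∣n!; m∣m*n)
import Data.Nat.Properties as ℕ
open import Data.Product.Base using (∃; ∃-syntax; _×_; _,_; proj₁; proj₂)
open import Data.Sum.Base using (_⊎_; inj₁; inj₂)
open import Data.Vec.Functional using (Vector; tail; _∷_)
open import Function.Base using (_∘_)
open import Function.Bundles using (Inverse)
open import Relation.Binary.Bundles using (Setoid; DecSetoid)
import Relation.Binary.Reasoning.Setoid as ≈-Reasoning
open import Relation.Binary.PropositionalEquality.Core as ≡ using (_≡_)
import Relation.Binary.PropositionalEquality.Properties as ≡
open import Relation.Nullary using (¬_; Dec; yes; no; contradiction)
open import Relation.Nullary.Decidable using (map′; _×-dec_; decidable-stable)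

private variable
  c ℓ₁ ℓ₂ d m₁ m₂ : Level

heytingField⇒commutativeRing : HeytingField c ℓ₁ ℓ₂ → CommutativeRing c ℓ₁
heytingField⇒commutativeRing H =
  HeytingCommutativeRing.commutativeRing (HeytingField.heytingCommutativeRing H)

module FieldProperties (H : HeytingField c ℓ₁ ℓ₂) where
  open HeytingField H using (_#_; #⇒invertible; tight)
  open CommutativeRing (heytingField⇒commutativeRing H) hiding (zero)
  open HeytingProperties (HeytingField.heytingCommutativeRing H) using (1#0)
  open Exponentiation commutativeSemiring using (_^_; ^-distrib-*; ^-assocʳ; ^-congˡ)
  open ≈-Reasoning setoid

  ≈⇒¬# : ∀ {x y} → x ≈ y → ¬ x # y
  ≈⇒¬# = proj₂ (tight _ _)

  ¬#⇒≈ : ∀ {x y} → ¬ x # y → x ≈ y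
  ¬#⇒≈ = proj₁ (tight _ _)

  1≉0 : ¬ 1# ≈ 0#
  1≉0 1≈0 = ≈⇒¬# 1≈0 1#0

  *-cancelˡ-invertible : ∀ {x y z} → y * x ≈ 1# → x * z ≈ 0# → z ≈ 0#
  *-cancelˡ-invertible {x} {y} {z} yx≈1 xz≈0 = begin
    z           ≈⟨ *-identityˡ z ⟨
    1# * z      ≈⟨ *-congʳ yx≈1 ⟨
    y * x * z   ≈⟨ *-assoc y x z ⟩
    y * (x * z) ≈⟨ *-congˡ xz≈0 ⟩
    y * 0#      ≈⟨ zeroʳ y ⟩
    0#          ∎

  #⇒*-cancelˡ : ∀ {x y z} → x # y → (x - y) * z ≈ 0# → z ≈ 0#
  #⇒*-cancelˡ x#y = *-cancelˡ-invertible (proj₁ (proj₂ (#⇒invertible x#y)))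

  1^n≈1 : ∀ n → 1# ^ n ≈ 1#
  1^n≈1 zero    = refl
  1^n≈1 (suc n) = trans (*-identityˡ _) (1^n≈1 n)

  *-root : ∀ n {x y} → x ^ n ≈ 1# → y ^ n ≈ 1# → (x * y) ^ n ≈ 1#
  *-root n xⁿ≈1 yⁿ≈1 = trans (^-distrib-* _ _ n) (trans (*-cong xⁿ≈1 yⁿ≈1) (*-identityˡ 1#))

  ∣-root : ∀ {m n} x → m ∣ n → x ^ m ≈ 1# → x ^ n ≈ 1#
  ∣-root {m} x (divides k ≡.refl) xᵐ≈1 = begin
    x ^ (k ℕ.* m) ≡⟨ ≡.cong (x ^_) (ℕ.*-comm k m) ⟩
    x ^ (m ℕ.* k) ≈⟨ ^-assocʳ x m k ⟨
    (x ^ m) ^ k   ≈⟨ ^-congˡ k xᵐ≈1 ⟩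
    1# ^ k        ≈⟨ 1^n≈1 k ⟩
    1#            ∎

-- A field with exactly q elements.  Being finite, it has decidable equality,
-- and its apartness relation is inequality.
record FiniteField c ℓ₁ ℓ₂ (q : ℕ) : Set (lsuc (c ⊔ ℓ₁ ⊔ ℓ₂)) where
  field
    heytingField : HeytingField c ℓ₁ ℓ₂

  open HeytingField heytingField public
    using (_#_; #⇒invertible)
  open CommutativeRing (heytingField⇒commutativeRing heytingField) public hiding (zero)

  field
    enumeration : Inverse setoid (≡.setoid (Fin q))

  open Inverse enumeration public using () renaming (to to index; from to element)
  open FieldProperties heytingField public
  open HeytingProperties (HeytingField.heytingCommutativeRing heytingField) using (x-0≈x)
  open Exponentiation commutativeSemiring public using (_^_; ^-homo-*)
  open RingProperties ring using (-‿distribʳ-*; x∙y⁻¹≈ε⇒x≈y)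

  element-index : ∀ x → element (index x) ≈ x
  element-index = Inverse.strictlyInverseʳ enumeration

  infix 4 _≟_
  _≟_ : ∀ x y → Dec (x ≈ y)
  x ≟ y = map′ index-injective (Inverse.to-cong enumeration) (index x Fin.≟ index y)
    where
    index-injective : index x ≡ index y → x ≈ y
    index-injective eq = trans (sym (element-index x)) (trans (reflexive (≡.cong element eq)) (element-index y))

  inverse? : ∀ x → Dec (∃[ i ] x * element i ≈ 1#)
  inverse? x = any? (λ i → x * element i ≟ 1#)

  -- The multiplicative inverse, made total by 0 ⁻¹ = 0.
  infix 8 _⁻¹
  _⁻¹ : Carrier → Carrier
  x ⁻¹ with inverse? x
  ... | yes (i , _) = element i
  ... | no  _       = 0#

  infixl 7 _/_
  _/_ : Carrier → Carrier → Carrier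
  x / y = x * y ⁻¹

  ⁻¹-inverseʳ : ∀ {x} → ¬ x ≈ 0# → x * x ⁻¹ ≈ 1#
  ⁻¹-inverseʳ {x} x≉0 with inverse? x
  ... | yes (_ , eq) = eq
  ... | no  ∄inverse = contradiction (¬#⇒≈ x¬#0) x≉0
    where
    x¬#0 : ¬ x # 0#
    x¬#0 x#0 with #⇒invertible x#0
    ... | y , _ , [x-0]y≈1 = ∄inverse (index y , trans (*-congˡ (element-index y)) (trans (*-congʳ (sym (x-0≈x x))) [x-0]y≈1))

  0⁻¹≈0 : ∀ {x} → x ≈ 0# → x ⁻¹ ≈ 0#
  0⁻¹≈0 {x} x≈0 with inverse? x
  ... | yes (_ , xy≈1) = contradiction (trans (sym xy≈1) (trans (*-congʳ x≈0) (zeroˡ _))) 1≉0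
  ... | no  _          = refl

  *-cancelˡ-nonZero : ∀ {x y z} → ¬ x ≈ 0# → x * y ≈ x * z → y ≈ z
  *-cancelˡ-nonZero {x} {y} {z} x≉0 xy≈xz =
    x∙y⁻¹≈ε⇒x≈y y z (*-cancelˡ-invertible (trans (*-comm (x ⁻¹) x) (⁻¹-inverseʳ x≉0)) (begin
      x * (y - z)       ≈⟨ distribˡ x y (- z) ⟩
      x * y + x * - z   ≈⟨ +-congˡ (-‿distribʳ-* x z) ⟨
      x * y - x * z     ≈⟨ +-congʳ xy≈xz ⟩
      x * z - x * z     ≈⟨ -‿inverseʳ (x * z) ⟩
      0#                ∎))
    where open ≈-Reasoning setoid

  ⁻¹-cong : ∀ {x y} → x ≈ y → x ⁻¹ ≈ y ⁻¹
  ⁻¹-cong {x} {y} x≈y with x ≟ 0#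
  ... | yes x≈0 = trans (0⁻¹≈0 x≈0) (sym (0⁻¹≈0 (trans (sym x≈y) x≈0)))
  ... | no  x≉0 = *-cancelˡ-nonZero x≉0 (trans (⁻¹-inverseʳ x≉0)
          (trans (sym (⁻¹-inverseʳ (x≉0 ∘ trans x≈y))) (*-congʳ (sym x≈y))))

  *-nonZero : ∀ {x y} → ¬ x ≈ 0# → ¬ y ≈ 0# → ¬ x * y ≈ 0#
  *-nonZero x≉0 y≉0 xy≈0 = y≉0 (*-cancelˡ-nonZero x≉0 (trans xy≈0 (sym (zeroʳ _))))

  ⁻¹-homo-* : ∀ x y → (x * y) ⁻¹ ≈ x ⁻¹ * y ⁻¹
  ⁻¹-homo-* x y with x ≟ 0# | y ≟ 0#
  ... | yes x≈0 | _       = trans (0⁻¹≈0 (trans (*-congʳ x≈0) (zeroˡ y)))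
                                  (sym (trans (*-congʳ (0⁻¹≈0 x≈0)) (zeroˡ _)))
  ... | no  _   | yes y≈0 = trans (0⁻¹≈0 (trans (*-congˡ y≈0) (zeroʳ x)))
                                  (sym (trans (*-congˡ (0⁻¹≈0 y≈0)) (zeroʳ _)))
  ... | no  x≉0 | no  y≉0 = *-cancelˡ-nonZero (*-nonZero x≉0 y≉0) (begin
    x * y * (x * y) ⁻¹         ≈⟨ ⁻¹-inverseʳ (*-nonZero x≉0 y≉0) ⟩
    1#                         ≈⟨ *-identityˡ 1# ⟨
    1# * 1#                    ≈⟨ *-cong (⁻¹-inverseʳ x≉0) (⁻¹-inverseʳ y≉0) ⟨
    x * x ⁻¹ * (y * y ⁻¹)      ≈⟨ interchange x (x ⁻¹) y (y ⁻¹) ⟩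
    x * y * (x ⁻¹ * y ⁻¹)      ∎)
    where
    open ≈-Reasoning setoid
    interchange : ∀ a b c d → a * b * (c * d) ≈ a * c * (b * d)
    interchange = solve 4 (λ a b c d → a :* b :* (c :* d) := a :* c :* (b :* d)) refl
      where open SemiringSolver commutativeSemiring

  1⁻¹≈1 : 1# ⁻¹ ≈ 1#
  1⁻¹≈1 = trans (sym (*-identityˡ _)) (⁻¹-inverseʳ 1≉0)

  ^-nonZero : ∀ {x} n → ¬ x ≈ 0# → ¬ x ^ n ≈ 0#
  ^-nonZero zero    x≉0 = 1≉0
  ^-nonZero (suc n) x≉0 = *-nonZero x≉0 (^-nonZero n x≉0)

  x^q!≈1 : ∀ {x} → ¬ x ≈ 0# → x ^ (q !) ≈ 1#
  x^q!≈1 {x} x≉0 with pigeonhole (ℕ.n<1+n q) (λ i → index (x ^ toℕ i))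
  ... | i , j , i<j , eq = ∣-root x (k∣q! k (ℕ.≤-trans k+i+1≤j (ℕ.≤-pred (Fin.toℕ<n j)))) xᵏ⁺¹≈1
    where
    k = toℕ j ℕ.∸ suc (toℕ i)
    i+[1+k]≡j : toℕ i ℕ.+ suc k ≡ toℕ j
    i+[1+k]≡j = ≡.trans (ℕ.+-suc (toℕ i) k) (ℕ.m+[n∸m]≡n i<j)
    k+i+1≤j : suc k ℕ.≤ toℕ j
    k+i+1≤j = ≡.subst (suc k ℕ.≤_) i+[1+k]≡j (ℕ.m≤n+m (suc k) (toℕ i))
    k∣q! : ∀ k → suc k ℕ.≤ q → suc k ∣ q !
    k∣q! k k<q = ∣-trans (m∣m*n (k !)) (m≤n⇒m!∣n! k<q)
    xⁱ≈xʲ : x ^ toℕ i ≈ x ^ toℕ j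
    xⁱ≈xʲ = trans (sym (element-index _)) (trans (reflexive (≡.cong element eq)) (element-index _))
    xᵏ⁺¹≈1 : x ^ suc k ≈ 1#
    xᵏ⁺¹≈1 = *-cancelˡ-nonZero (^-nonZero (toℕ i) x≉0) (begin
      x ^ toℕ i * x ^ suc k   ≈⟨ ^-homo-* x (toℕ i) (suc k) ⟨
      x ^ (toℕ i ℕ.+ suc k)   ≡⟨ ≡.cong (x ^_) i+[1+k]≡j ⟩
      x ^ toℕ j               ≈⟨ xⁱ≈xʲ ⟨
      x ^ toℕ i               ≈⟨ *-identityʳ _ ⟨
      x ^ toℕ i * 1#          ∎)
      where open ≈-Reasoning setoid

-- The library has no complex numbers.  Characters take their values in an
-- arbitrary algebraically closed field of characteristic zero, of which ℂ is
-- one; equality of complex numbers is undecidable, hence a Heyting field.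
record AlgebraicallyClosedField₀ c ℓ₁ ℓ₂ : Set (lsuc (c ⊔ ℓ₁ ⊔ ℓ₂)) where
  field
    heytingField : HeytingField c ℓ₁ ℓ₂

  open HeytingField heytingField public
    using (_#_; #⇒invertible; #-cotrans)
  open CommutativeRing (heytingField⇒commutativeRing heytingField) public hiding (zero)
  open Exponentiation commutativeSemiring public
    using (_^_; ^-homo-*; ^-distrib-*; ^-assocʳ; ^-congˡ)
  open Multiples semiring public using () renaming (_×_ to _·ℕ_)
  open Summation semiring public using (sum; sum-syntax; sum-cong-≋; *-distribˡ-sum)

  field
    characteristicZero : ∀ n → (suc n ·ℕ 1#) # 0#
    algebraicallyClosed : ∀ n (a : Vector Carrier (suc n)) →
      ∃[ z ] z ^ suc n + ∑[ i < suc n ] (a i * z ^ toℕ i) ≈ 0#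

  open FieldProperties heytingField public
  open HeytingProperties (HeytingField.heytingCommutativeRing heytingField) public using (x-0≈x)
  open RingProperties ring using (x∙y⁻¹≈ε⇒x≈y)
  private module Solver = SemiringSolver commutativeSemiring

  -- 1 / n, with the value 0 at n = 0; it is used at q - 1, which is positive
  -- because a field has at least two elements.
  reciprocal : ℕ → Carrier
  reciprocal zero    = 0#
  reciprocal (suc n) = proj₁ (#⇒invertible (characteristicZero n))

  -- a₀ + a₁ z + ⋯ + aₙ₋₁ zⁿ⁻¹ + zⁿ
  monic : ∀ {n} → Vector Carrier n → Carrier → Carrier
  monic {zero}  a z = 1#
  monic {suc n} a z = a zero + z * monic (tail a) z

  monic≈ : ∀ n (a : Vector Carrier n) z → z ^ n + ∑[ i < n ] (a i * z ^ toℕ i) ≈ monic a z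
  monic≈ zero    a z = +-identityʳ 1#
  monic≈ (suc n) a z = begin
    z * z ^ n + (a zero * 1# + ∑[ i < n ] (a (suc i) * (z * z ^ toℕ i)))
      ≈⟨ +-congˡ (+-cong (*-identityʳ _) (sum-cong-≋ λ i → x∙yz≈y∙xz (a (suc i)) z (z ^ toℕ i))) ⟩
    z * z ^ n + (a zero + ∑[ i < n ] (z * (a (suc i) * z ^ toℕ i)))
      ≈⟨ +-congˡ (+-congˡ (*-distribˡ-sum z (λ i → a (suc i) * z ^ toℕ i))) ⟨
    z * z ^ n + (a zero + z * (∑[ i < n ] (a (suc i) * z ^ toℕ i)))
      ≈⟨ rearrange z (z ^ n) (a zero) _ ⟩
    a zero + z * (z ^ n + ∑[ i < n ] (a (suc i) * z ^ toℕ i))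
      ≈⟨ +-congˡ (*-congˡ (monic≈ n (tail a) z)) ⟩
    monic a z ∎
    where
    open ≈-Reasoning setoid
    open Solver
    x∙yz≈y∙xz : ∀ x y z → x * (y * z) ≈ y * (x * z)
    x∙yz≈y∙xz = solve 3 (λ x y z → x :* (y :* z) := y :* (x :* z)) refl
    rearrange : ∀ z p a s → z * p + (a + z * s) ≈ a + z * (p + s)
    rearrange = solve 4 (λ z p a s → z :* p :+ (a :+ z :* s) := a :+ z :* (p :+ s)) refl

  x≈y+[x-y] : ∀ x y → x ≈ y + (x - y)
  x≈y+[x-y] x y = begin
    x             ≈⟨ +-identityʳ x ⟨
    x + 0#        ≈⟨ +-congˡ (-‿inverseˡ y) ⟨
    x + (- y + y) ≈⟨ +-assoc x (- y) y ⟨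
    (x - y) + y   ≈⟨ +-comm (x - y) y ⟩
    y + (x - y)   ∎
    where open ≈-Reasoning setoid

  quotient : ∀ {n} → Carrier → Vector Carrier (suc n) → Vector Carrier n
  quotient {zero}  r a = λ ()
  quotient {suc n} r a = monic (tail a) r ∷ quotient r (tail a)

  monic-quotient : ∀ {n} r (a : Vector Carrier (suc n)) z →
                   monic a z ≈ monic a r + (z - r) * monic (quotient r a) z
  monic-quotient {zero} r a z = begin
    a zero + z * 1#                       ≈⟨ +-congˡ (*-congʳ (x≈y+[x-y] z r)) ⟩
    a zero + (r + (z - r)) * 1#           ≈⟨ expand (a zero) r (z - r) ⟩
    (a zero + r * 1#) + (z - r) * 1#      ∎
    where
    open ≈-Reasoning setoid
    open Solver
    expand : ∀ a r d → a + (r + d) * 1# ≈ (a + r * 1#) + d * 1#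
    expand = solve 3 (λ a r d → a :+ (r :+ d) :* con 1 := (a :+ r :* con 1) :+ d :* con 1) refl
  monic-quotient {suc n} r a z = begin
    a zero + z * monic (tail a) z                        ≈⟨ +-congˡ (*-congˡ (monic-quotient r (tail a) z)) ⟩
    a zero + z * (P + D * Q)                             ≈⟨ +-congˡ (*-congʳ (x≈y+[x-y] z r)) ⟩
    a zero + (r + D) * (P + D * Q)                       ≈⟨ expand (a zero) r D P Q ⟩
    (a zero + r * P) + D * (P + (r + D) * Q)             ≈⟨ +-congˡ (*-congˡ (+-congˡ (*-congʳ (x≈y+[x-y] z r)))) ⟨
    (a zero + r * P) + D * (P + z * Q)                   ∎
    where
    open ≈-Reasoning setoid
    open Solver
    P = monic (tail a) r
    D = z - r
    Q = monic (quotient r (tail a)) z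
    expand : ∀ a r d p q → a + (r + d) * (p + d * q) ≈ (a + r * p) + d * (p + (r + d) * q)
    expand = solve 5 (λ a r d p q →
      a :+ (r :+ d) :* (p :+ d :* q) := (a :+ r :* p) :+ d :* (p :+ (r :+ d) :* q)) refl

  roots : ∀ {n} → Vector Carrier n → Vector Carrier n
  roots {suc n} a = r ∷ roots (quotient r a)
    where r = proj₁ (algebraicallyClosed n a)

  monic-splits : ∀ {n} (a : Vector Carrier n) z →
                 monic a z ≈ 0# → ¬ (∀ i → ¬ z ≈ roots a i)
  monic-splits {zero}  a z 1≈0 _      = 1≉0 1≈0
  monic-splits {suc n} a z az≈0 z≉root = z≉root zero (¬#⇒≈ λ z#r →
    monic-splits (quotient r a) z (#⇒*-cancelˡ z#r [z-r]q≈0) (z≉root ∘ suc))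
    where
    r = proj₁ (algebraicallyClosed n a)
    ar≈0 : monic a r ≈ 0#
    ar≈0 = trans (sym (monic≈ (suc n) a r)) (proj₂ (algebraicallyClosed n a))
    [z-r]q≈0 : (z - r) * monic (quotient r a) z ≈ 0#
    [z-r]q≈0 = trans (sym (trans (monic-quotient r a z) (trans (+-congʳ ar≈0) (+-identityˡ _)))) az≈0

  monic-roots : ∀ {n} (a : Vector Carrier n) i → monic a (roots a i) ≈ 0#
  monic-roots {suc n} a zero    =
    trans (sym (monic≈ (suc n) a _)) (proj₂ (algebraicallyClosed n a))
  monic-roots {suc n} a (suc i) = begin
    monic a z                                 ≈⟨ monic-quotient r a z ⟩
    monic a r + (z - r) * monic (quotient r a) z ≈⟨ +-cong (monic-roots a zero) (*-congˡ (monic-roots (quotient r a) i)) ⟩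
    0# + (z - r) * 0#                         ≈⟨ trans (+-identityˡ _) (zeroʳ _) ⟩
    0#                                        ∎
    where
    open ≈-Reasoning setoid
    r = proj₁ (algebraicallyClosed n a)
    z = roots (quotient r a) i

  -- zⁿ⁺¹ - 1
  xⁿ⁺¹-1 : ∀ n → Vector Carrier (suc n)
  xⁿ⁺¹-1 n = - 1# ∷ λ _ → 0#

  monic-xⁿ⁺¹-1 : ∀ n z → monic (xⁿ⁺¹-1 n) z ≈ z ^ suc n - 1#
  monic-xⁿ⁺¹-1 n z = trans (+-congˡ (*-congˡ (power n))) (+-comm _ _)
    where
    power : ∀ n → monic {n} (λ _ → 0#) z ≈ z ^ n
    power zero    = refl
    power (suc n) = trans (+-identityˡ _) (*-congˡ (power n))

  -- Equality of roots of unity is decidable: with u = 1 + d and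
  -- g = 1 + u + ⋯ + uⁿ⁻¹ one has uⁿ = 1 + d g and g = n + d t.
  module _ (u : Carrier) where
    private
      D = u - 1#
      g t : ℕ → Carrier
      g zero    = 0#
      g (suc n) = 1# + u * g n
      t zero    = 0#
      t (suc n) = t n + g n

      u≈1+D : u ≈ 1# + D
      u≈1+D = x≈y+[x-y] u 1#

      uⁿ≈1+Dg : ∀ n → u ^ n ≈ 1# + D * g n
      uⁿ≈1+Dg zero    = sym (trans (+-congˡ (zeroʳ D)) (+-identityʳ 1#))
      uⁿ≈1+Dg (suc n) = begin
        u * u ^ n                       ≈⟨ *-cong u≈1+D (uⁿ≈1+Dg n) ⟩
        (1# + D) * (1# + D * g n)       ≈⟨ expand D (g n) ⟩
        1# + D * (1# + (1# + D) * g n)  ≈⟨ +-congˡ (*-congˡ (+-congˡ (*-congʳ u≈1+D))) ⟨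
        1# + D * (1# + u * g n)         ∎
        where
        open ≈-Reasoning setoid
        open Solver
        expand : ∀ d g → (1# + d) * (1# + d * g) ≈ 1# + d * (1# + (1# + d) * g)
        expand = solve 2 (λ d g → (con 1 :+ d) :* (con 1 :+ d :* g)
          := con 1 :+ d :* (con 1 :+ (con 1 :+ d) :* g)) refl

      g≈n+Dt : ∀ n → g n ≈ n ·ℕ 1# + D * t n
      g≈n+Dt zero    = sym (trans (+-identityˡ _) (zeroʳ D))
      g≈n+Dt (suc n) = begin
        1# + u * g n                       ≈⟨ +-congˡ (*-congʳ u≈1+D) ⟩
        1# + (1# + D) * g n                ≈⟨ expand₁ D (g n) ⟩
        1# + (g n + D * g n)               ≈⟨ +-congˡ (+-congʳ (g≈n+Dt n)) ⟩
        1# + (n ·ℕ 1# + D * t n + D * g n) ≈⟨ expand₂ D (g n) (t n) (n ·ℕ 1#) ⟩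
        1# + n ·ℕ 1# + D * (t n + g n)     ∎
        where
        open ≈-Reasoning setoid
        open Solver
        expand₁ : ∀ d g → 1# + (1# + d) * g ≈ 1# + (g + d * g)
        expand₁ = solve 2 (λ d g → con 1 :+ (con 1 :+ d) :* g := con 1 :+ (g :+ d :* g)) refl
        expand₂ : ∀ d g t n → 1# + (n + d * t + d * g) ≈ 1# + n + d * (t + g)
        expand₂ = solve 4 (λ d g t n → con 1 :+ (n :+ d :* t :+ d :* g)
          := con 1 :+ n :+ d :* (t :+ g)) refl

    root≟1 : ∀ m → u ^ suc m ≈ 1# → Dec (u ≈ 1#)
    root≟1 m uⁿ≈1 with #-cotrans (characteristicZero m) (g (suc m))
    ... | inj₁ n#g = no λ u≈1 → ≈⇒¬# (n≈g u≈1) n#g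
      where
      n≈g : u ≈ 1# → suc m ·ℕ 1# ≈ g (suc m)
      n≈g u≈1 = sym (trans (g≈n+Dt (suc m)) (trans (+-congˡ (trans
        (*-congʳ (trans (+-congʳ u≈1) (-‿inverseʳ 1#))) (zeroˡ _))) (+-identityʳ _)))
    ... | inj₂ g#0 = yes (x∙y⁻¹≈ε⇒x≈y u 1# (#⇒*-cancelˡ g#0 [g-0]D≈0))
      where
      open ≈-Reasoning setoid
      [g-0]D≈0 : (g (suc m) - 0#) * D ≈ 0#
      [g-0]D≈0 = begin
        (g (suc m) - 0#) * D        ≈⟨ *-congʳ (x-0≈x _) ⟩
        g (suc m) * D               ≈⟨ *-comm _ D ⟩
        D * g (suc m)               ≈⟨ +-identityʳ _ ⟨
        D * g (suc m) + 0#          ≈⟨ +-congˡ (-‿inverseʳ 1#) ⟨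
        D * g (suc m) + (1# - 1#)   ≈⟨ +-assoc _ 1# (- 1#) ⟨
        D * g (suc m) + 1# - 1#     ≈⟨ +-congʳ (+-comm _ 1#) ⟩
        1# + D * g (suc m) - 1#     ≈⟨ +-congʳ (uⁿ≈1+Dg (suc m)) ⟨
        u ^ suc m - 1#              ≈⟨ +-congʳ uⁿ≈1 ⟩
        1# - 1#                     ≈⟨ -‿inverseʳ 1# ⟩
        0#                          ∎

  -- The possible values of a character, for n = suc m a multiple of the
  -- exponent of the group.
  module _ (m : ℕ) where
    private n = suc m

    IsValue : Carrier → Set ℓ₁
    IsValue z = z ≈ 0# ⊎ z ^ n ≈ 1#

    0≉root : ∀ {z} → z ≈ 0# → ¬ z ^ n ≈ 1#
    0≉root z≈0 zⁿ≈1 = 1≉0 (trans (sym zⁿ≈1) (trans (*-congʳ z≈0) (zeroˡ _)))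

    root-≟ : ∀ {z w} → z ^ n ≈ 1# → w ^ n ≈ 1# → Dec (z ≈ w)
    root-≟ {z} {w} zⁿ≈1 wⁿ≈1 = map′ to from (root≟1 u m uⁿ≈1)
      where
      open ≈-Reasoning setoid
      u = z * w ^ m
      uⁿ≈1 : u ^ n ≈ 1#
      uⁿ≈1 = *-root n zⁿ≈1 (trans (^-assocʳ w m n) (∣-root w (divides m ≡.refl) wⁿ≈1))
      to : u ≈ 1# → z ≈ w
      to u≈1 = begin
        z                 ≈⟨ *-identityʳ z ⟨
        z * 1#            ≈⟨ *-congˡ (trans (*-comm (w ^ m) w) wⁿ≈1) ⟨
        z * (w ^ m * w)   ≈⟨ *-assoc z (w ^ m) w ⟨
        z * w ^ m * w     ≈⟨ *-congʳ u≈1 ⟩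
        1# * w            ≈⟨ *-identityˡ w ⟩
        w                 ∎
      from : z ≈ w → u ≈ 1#
      from z≈w = trans (*-congʳ z≈w) wⁿ≈1

    value-≟ : ∀ {z w} → IsValue z → IsValue w → Dec (z ≈ w)
    value-≟ (inj₁ z≈0)  (inj₁ w≈0)  = yes (trans z≈0 (sym w≈0))
    value-≟ (inj₁ z≈0)  (inj₂ wⁿ≈1) = no λ z≈w → 0≉root (trans (sym z≈w) z≈0) wⁿ≈1
    value-≟ (inj₂ zⁿ≈1) (inj₁ w≈0)  = no λ z≈w → 0≉root (trans z≈w w≈0) zⁿ≈1
    value-≟ (inj₂ zⁿ≈1) (inj₂ wⁿ≈1) = root-≟ zⁿ≈1 wⁿ≈1

    value-0 : IsValue 0#
    value-0 = inj₁ refl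

    value-1 : IsValue 1#
    value-1 = inj₂ (1^n≈1 n)

    value-* : ∀ {z w} → IsValue z → IsValue w → IsValue (z * w)
    value-* (inj₁ z≈0)  _           = inj₁ (trans (*-congʳ z≈0) (zeroˡ _))
    value-* (inj₂ _)    (inj₁ w≈0)  = inj₁ (trans (*-congˡ w≈0) (zeroʳ _))
    value-* (inj₂ zⁿ≈1) (inj₂ wⁿ≈1) = inj₂ (*-root n zⁿ≈1 wⁿ≈1)

    value : Fin (suc n) → Carrier
    value zero    = 0#
    value (suc i) = roots (xⁿ⁺¹-1 m) i

    xⁿ⁺¹-1-roots : ∀ i → roots (xⁿ⁺¹-1 m) i ^ n ≈ 1#
    xⁿ⁺¹-1-roots i = x∙y⁻¹≈ε⇒x≈y _ 1#
      (trans (sym (monic-xⁿ⁺¹-1 m _)) (monic-roots (xⁿ⁺¹-1 m) i))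

    isValue : ∀ i → IsValue (value i)
    isValue zero    = value-0
    isValue (suc i) = inj₂ (xⁿ⁺¹-1-roots i)

    value-surjective : ∀ {z} → IsValue z → ∃[ i ] z ≈ value i
    value-surjective {z} (inj₁ z≈0) = zero , z≈0
    value-surjective {z} (inj₂ zⁿ≈1) = suc (proj₁ root) , proj₂ root
      where
      root : ∃[ i ] z ≈ value (suc i)
      root = decidable-stable (any? λ i → root-≟ zⁿ≈1 (xⁿ⁺¹-1-roots i)) λ ∄root →
        monic-splits (xⁿ⁺¹-1 m) z
          (trans (monic-xⁿ⁺¹-1 m z) (trans (+-congʳ zⁿ≈1) (-‿inverseʳ 1#)))
          (λ i z≈root → ∄root (i , z≈root))

module Characters {q : ℕ} (F : FiniteField c ℓ₁ ℓ₂ q) (K : AlgebraicallyClosedField₀ d m₁ m₂) where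
  module F = FiniteField F
  module K = AlgebraicallyClosedField₀ K

  open MonoidMorphisms F.*-rawMonoid K.*-rawMonoid using (IsMonoidHomomorphism)

  -- A homomorphism from the nonzero elements of F to the nonzero elements of K,
  -- extended to F by χ(0) = 0.  (χ(x) is nonzero for x ≠ 0, as χ(x) χ(x⁻¹) = 1.)
  record Character : Set (c ⊔ ℓ₁ ⊔ d ⊔ m₁) where
    field
      ⟦_⟧                  : F.Carrier → K.Carrier
      isMonoidHomomorphism : IsMonoidHomomorphism ⟦_⟧
      0#-homo              : ⟦ F.0# ⟧ K.≈ K.0#

    open IsMonoidHomomorphism isMonoidHomomorphism public
      using (⟦⟧-cong) renaming (homo to *-homo; ε-homo to 1#-homo)

  open Character public using (⟦_⟧)

  character : (f : F.Carrier → K.Carrier) → (∀ {x y} → x F.≈ y → f x K.≈ f y) →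
              f F.0# K.≈ K.0# → f F.1# K.≈ K.1# →
              (∀ x y → f (x F.* y) K.≈ f x K.* f y) → Character
  character f f-cong f0 f1 f* = record
    { ⟦_⟧ = f
    ; isMonoidHomomorphism = record
      { isMagmaHomomorphism = record
        { isRelHomomorphism = record { cong = f-cong }
        ; homo = f*
        }
      ; ε-homo = f1
      }
    ; 0#-homo = f0
    }

  characterSetoid : Setoid _ _
  characterSetoid = record
    { Carrier = Character
    ; _≈_ = λ χ ψ → ∀ x → ⟦ χ ⟧ x K.≈ ⟦ ψ ⟧ x
    ; isEquivalence = record
      { refl  = λ _ → K.refl
      ; sym   = λ χ≈ψ x → K.sym (χ≈ψ x)
      ; trans = λ χ≈ψ ψ≈φ x → K.trans (χ≈ψ x) (ψ≈φ x)
      }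
    }

  open Setoid characterSetoid public using () renaming (_≈_ to _≈ᶜ_)

  -- The trivial character; like every other one it vanishes at 0.
  ε : Character
  ε = character ε′ ε′-cong ε′-0 ε′-1 ε′-*
    where
    ε′ : F.Carrier → K.Carrier
    ε′ x with x F.≟ F.0#
    ... | yes _ = K.0#
    ... | no  _ = K.1#
    ε′-cong : ∀ {x y} → x F.≈ y → ε′ x K.≈ ε′ y
    ε′-cong {x} {y} x≈y with x F.≟ F.0# | y F.≟ F.0#
    ... | yes _   | yes _   = K.refl
    ... | yes x≈0 | no  y≉0 = contradiction (F.trans (F.sym x≈y) x≈0) y≉0
    ... | no  x≉0 | yes y≈0 = contradiction (F.trans x≈y y≈0) x≉0
    ... | no  _   | no  _   = K.refl
    ε′-0 : ε′ F.0# K.≈ K.0#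
    ε′-0 with F.0# F.≟ F.0#
    ... | yes _   = K.refl
    ... | no  0≉0 = contradiction F.refl 0≉0
    ε′-1 : ε′ F.1# K.≈ K.1#
    ε′-1 with F.1# F.≟ F.0#
    ... | yes 1≈0 = contradiction 1≈0 F.1≉0
    ... | no  _   = K.refl
    ε′-* : ∀ x y → ε′ (x F.* y) K.≈ ε′ x K.* ε′ y
    ε′-* x y with x F.≟ F.0# | y F.≟ F.0# | x F.* y F.≟ F.0#
    ... | yes _   | _       | yes _    = K.sym (K.zeroˡ _)
    ... | yes x≈0 | _       | no  xy≉0 = contradiction (F.trans (F.*-congʳ x≈0) (F.zeroˡ y)) xy≉0
    ... | no  _   | yes _   | yes _    = K.sym (K.zeroʳ _)
    ... | no  _   | yes y≈0 | no  xy≉0 = contradiction (F.trans (F.*-congˡ y≈0) (F.zeroʳ x)) xy≉0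
    ... | no  x≉0 | no  y≉0 | yes xy≈0 = contradiction xy≈0 (F.*-nonZero x≉0 y≉0)
    ... | no  _   | no  _   | no  _    = K.sym (K.*-identityˡ _)

  infixl 7 _·_
  _·_ : Character → Character → Character
  χ · ψ = character (λ x → ⟦ χ ⟧ x K.* ⟦ ψ ⟧ x)
    (λ x≈y → K.*-cong (χ.⟦⟧-cong x≈y) (ψ.⟦⟧-cong x≈y))
    (K.trans (K.*-congʳ χ.0#-homo) (K.zeroˡ _))
    (K.trans (K.*-cong χ.1#-homo ψ.1#-homo) (K.*-identityˡ _))
    (λ x y → K.trans (K.*-cong (χ.*-homo x y) (ψ.*-homo x y)) (interchange _ _ _ _))
    where
    module χ = Character χ
    module ψ = Character ψ
    open SemiringSolver K.commutativeSemiring using (solve; _:*_; _:=_)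
    interchange : ∀ a b c d → a K.* b K.* (c K.* d) K.≈ a K.* c K.* (b K.* d)
    interchange = solve 4 (λ a b c d → a :* b :* (c :* d) := a :* c :* (b :* d)) K.refl

  -- The inverse character χ̄; note that χ(0⁻¹) = χ(0) = 0.
  infix 8 _⁻
  _⁻ : Character → Character
  χ ⁻ = character (λ x → ⟦ χ ⟧ (x F.⁻¹))
    (λ x≈y → χ.⟦⟧-cong (F.⁻¹-cong x≈y))
    (K.trans (χ.⟦⟧-cong (F.0⁻¹≈0 F.refl)) χ.0#-homo)
    (K.trans (χ.⟦⟧-cong F.1⁻¹≈1) χ.1#-homo)
    (λ x y → K.trans (χ.⟦⟧-cong (F.⁻¹-homo-* x y)) (χ.*-homo _ _))
    where module χ = Character χ

  private
    m = ℕ.pred (q !)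

    suc-m≡q! : suc m ≡ q !
    suc-m≡q! = ℕ.suc-pred (q !) {{q ℕ.!≢0}}

    character-^ : ∀ χ x n → ⟦ χ ⟧ (x F.^ n) K.≈ ⟦ χ ⟧ x K.^ n
    character-^ χ x zero    = Character.1#-homo χ
    character-^ χ x (suc n) = K.trans (Character.*-homo χ x _) (K.*-congˡ (character-^ χ x n))

    character-value : ∀ χ x → K.IsValue m (⟦ χ ⟧ x)
    character-value χ x with x F.≟ F.0#
    ... | yes x≈0 = inj₁ (K.trans (Character.⟦⟧-cong χ x≈0) (Character.0#-homo χ))
    ... | no  x≉0 = inj₂ (K.trans (K.sym (character-^ χ x (suc m)))
      (K.trans (Character.⟦⟧-cong χ (F.trans (F.reflexive (≡.cong (x F.^_) suc-m≡q!)) (F.x^q!≈1 x≉0)))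
        (Character.1#-homo χ)))

    IsCharacter : (F.Carrier → K.Carrier) → Set _
    IsCharacter f = f F.0# K.≈ K.0# × f F.1# K.≈ K.1# ×
      (∀ i j → f (F.element i F.* F.element j) K.≈ f (F.element i) K.* f (F.element j))

    isCharacter? : ∀ f → (∀ x → K.IsValue m (f x)) → Dec (IsCharacter f)
    isCharacter? f v =
      K.value-≟ m (v _) (K.value-0 m) ×-dec
      K.value-≟ m (v _) (K.value-1 m) ×-dec
      Fin.all? (λ i → Fin.all? (λ j → K.value-≟ m (v _) (K.value-* m (v _) (v _))))

    isCharacter⇒character : ∀ f → (∀ {x y} → x F.≈ y → f x K.≈ f y) → IsCharacter f → Character
    isCharacter⇒character f f-cong (f0 , f1 , f*) = character f f-cong f0 f1 λ x y →
      K.trans (f-cong (F.*-cong (F.sym (F.element-index x)) (F.sym (F.element-index y))))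
        (K.trans (f* (F.index x) (F.index y))
          (K.*-cong (f-cong (F.element-index x)) (f-cong (F.element-index y))))

    candidate : Fin (suc (suc m) ℕ.^ q) → F.Carrier → K.Carrier
    candidate k x = K.value m (finToFun k (F.index x))

    candidate-cong : ∀ k {x y} → x F.≈ y → candidate k x K.≈ candidate k y
    candidate-cong k x≈y =
      K.reflexive (≡.cong (λ i → K.value m (finToFun k i)) (Inverse.to-cong F.enumeration x≈y))

    candidate? : ∀ k → Dec (IsCharacter (candidate k))
    candidate? k = isCharacter? (candidate k) (λ x → K.isValue m (finToFun k (F.index x)))

    select′ : ∀ k → Dec (IsCharacter (candidate k)) → Maybe Character
    select′ k (yes isChar) = just (isCharacter⇒character (candidate k) (candidate-cong k) isChar)
    select′ k (no  _)      = nothing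

    select : Fin (suc (suc m) ℕ.^ q) → Maybe Character
    select k = select′ k (candidate? k)

    code : Character → Fin (suc (suc m) ℕ.^ q)
    code χ = funToFin (λ i → proj₁ (K.value-surjective m (character-value χ (F.element i))))

    candidate-code : ∀ χ x → ⟦ χ ⟧ x K.≈ candidate (code χ) x
    candidate-code χ x = K.trans (Character.⟦⟧-cong χ (F.sym (F.element-index x)))
      (K.trans (proj₂ (K.value-surjective m (character-value χ (F.element (F.index x)))))
        (K.reflexive (≡.cong (K.value m) (≡.sym (finToFun-funToFin _ (F.index x))))))

    isCharacter-candidate : ∀ χ → IsCharacter (candidate (code χ))
    isCharacter-candidate χ =
        K.trans (K.sym (candidate-code χ _)) (Character.0#-homo χ)
      , K.trans (K.sym (candidate-code χ _)) (Character.1#-homo χ)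
      , λ i j → K.trans (K.sym (candidate-code χ _)) (K.trans (Character.*-homo χ _ _)
          (K.*-cong (candidate-code χ _) (candidate-code χ _)))

    select′-code : ∀ χ char? → MAny.Any (χ ≈ᶜ_) (select′ (code χ) char?)
    select′-code χ (yes _)    = just (candidate-code χ)
    select′-code χ (no ¬char) = contradiction (isCharacter-candidate χ) ¬char

    selection : List Character
    selection = mapMaybe select (allFin _)

    selection-enumerates : IsEnumeration characterSetoid selection
    selection-enumerates χ = Any.mapMaybe⁺ select (allFin _)
      (Any.map⁺ (Any.map (λ { ≡.refl → select′-code χ (candidate? (code χ)) }) (∈-allFin (code χ))))

  characterDecSetoid : DecSetoid _ _
  characterDecSetoid = record
    { isDecEquivalence = record
      { isEquivalence = Setoid.isEquivalence characterSetoid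
      ; _≟_ = λ χ ψ → map′
          (λ eq x → K.trans (Character.⟦⟧-cong χ (F.sym (F.element-index x)))
            (K.trans (eq (F.index x)) (Character.⟦⟧-cong ψ (F.element-index x))))
          (λ eq i → eq (F.element i))
          (Fin.all? (λ i → K.value-≟ m (character-value χ _) (character-value ψ _)))
      }
    }

  opaque
    -- All characters, each listed exactly once.
    characters : List Character
    characters = deduplicate (DecSetoid._≟_ characterDecSetoid) selection

    characters-enumerates : IsEnumeration characterSetoid characters
    characters-enumerates = deduplicate⁺ characterDecSetoid selection-enumerates

    characters-unique : Unique characterSetoid characters
    characters-unique = deduplicate-! characterDecSetoid selection

  ∑ᶠ : (F.Carrier → K.Carrier) → K.Carrier
  ∑ᶠ f = K.sum (λ i → f (F.element i))

  ∑ᶜ : (Character → K.Carrier) → K.Carrier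
  ∑ᶜ f = K.sum (λ i → f (lookup characters i))

  infixl 10 ∑ᶠ-syntax ∑ᶜ-syntax
  ∑ᶠ-syntax = ∑ᶠ
  ∑ᶜ-syntax = ∑ᶜ
  syntax ∑ᶠ-syntax (λ u → e) = ∑ᶠ[ u ] e
  syntax ∑ᶜ-syntax (λ χ → e) = ∑ᶜ[ χ ] e

  -1ᶠ : F.Carrier
  -1ᶠ = F.- F.1#

  J : Character → Character → K.Carrier
  J χ ψ = ∑ᶠ[ u ] (⟦ χ ⟧ u K.* ⟦ ψ ⟧ (F.1# F.- u))

  binomial : Character → Character → K.Carrier
  binomial A B = ⟦ B ⟧ -1ᶠ K.* J A (B ⁻)

  ₃F₂ : (A₀ A₁ A₂ B₁ B₂ : Character) → F.Carrier → K.Carrier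
  ₃F₂ A₀ A₁ A₂ B₁ B₂ x = K.reciprocal (q ℕ.∸ 1) K.*
    ∑ᶜ[ χ ] (binomial (A₀ · χ) χ K.* binomial (A₁ · χ) (B₁ · χ) K.* binomial (A₂ · χ) (B₂ · χ) K.* ⟦ χ ⟧ x)

  F₂ : (A B B′ C C′ : Character) → (x y : F.Carrier) → K.Carrier
  F₂ A B B′ C C′ x y = ⟦ ε ⟧ (x F.* y) K.* ⟦ B · B′ · C · C′ ⟧ -1ᶠ K.*
    ∑ᶠ[ u ] ∑ᶠ[ v ] (⟦ B ⟧ u K.* ⟦ B′ ⟧ v K.* ⟦ B ⁻ · C ⟧ (F.1# F.- u) K.* ⟦ B′ ⁻ · C′ ⟧ (F.1# F.- v)
      K.* ⟦ A ⁻ ⟧ (F.1# F.- u F.* x F.- v F.* y))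

{-# OPTIONS --safe #-}
module Submission where

-- Expanding the binomials of ₃F₂ as Jacobi sums over s, t, w, orthogonality of
-- characters evaluates the sum over s and χ (the binomial theorem for ₁F₀), which
-- leaves a sum over t and w.  The substitution u = 1/(1 - t), v = 1/w turns the
-- double sum of F₂ into it term by term: with ω(t) = -t/(1 - t) one has
-- 1 - u = ω(t), 1 - v = 1/ω(w) and, for y = -ω(t) ω(w) x/(1 - x),
-- 1 - u x - v (1 - x) = (1 - x) (1 - y) / ω(w).
--
-- Orthogonality needs, for g ≠ 0, 1, a character with χ(g) ≠ 1.  Starting from
-- f = T_g δ₁ - δ₁ ≠ 0, where (T_h f)(x) = f(h x), a nonzero common eigenfunction
-- of all T_h is obtained by splitting the polynomials zᴺ - 1 that annihilate the
-- T_h; its eigenvalues form a character χ, and χ(g) = 1 would make it vanish.  As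
-- equality of values is undecidable, χ only exists under double negation, which
-- suffices because equality is ¬¬-stable.

open import Defs
open import Level using (Level; _⊔_)
open import Algebra.Bundles using (CommutativeMonoid)
import Algebra.Properties.CommutativeMonoid.Sum as MonoidSum
import Algebra.Properties.CommutativeSemigroup as CommutativeSemigroupProperties
import Algebra.Properties.Ring as RingProperties
import Algebra.Properties.Semiring.Mult as Multiples
import Algebra.Properties.Semiring.Sum as Summation
import Algebra.Solver.CommutativeMonoid as MonoidSolver
import Algebra.Solver.Ring.NaturalCoefficients.Default as SemiringSolver
open import Data.Fin.Base using (Fin; zero; suc; punchIn)
open import Data.Fin.Properties using (punchInᵢ≢i)
open import Data.List.Base using (length; lookup)
open import Data.List.Membership.Propositional.Properties using (∈-lookup)
import Data.List.Relation.Unary.All as All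
import Data.List.Relation.Unary.Any as Any
open import Data.List.Relation.Unary.Any.Properties using (lookup-index)
open import Data.List.Relation.Unary.AllPairs using (_∷_)
open import Data.List.Relation.Unary.Enumerates.Setoid using (IsEnumeration)
open import Data.List.Relation.Unary.Unique.Setoid using (Unique)
open import Data.Nat.Base as ℕ using (ℕ; zero; suc; _^_)
open import Data.Nat.Primality using (Prime)
import Data.Nat.Properties as ℕ
open import Data.Product.Base using (∃-syntax; _×_; _,_; proj₁; proj₂)
open import Data.Vec.Functional using (Vector; tail)
open import Function.Base using (_∘_)
open import Function.Bundles using (Inverse)
import Function.Consequences.Setoid as Consequences
import Function.Construct.Composition as Composition
import Function.Construct.Symmetry as Symmetry
open import Relation.Binary.Bundles using (Setoid)
open import Relation.Nullary using (¬_; yes; no; contradiction)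
open import Relation.Binary.PropositionalEquality.Core as ≡ using (_≡_)
import Relation.Binary.PropositionalEquality.Properties as ≡
import Relation.Binary.Reasoning.Setoid as ≈-Reasoning

-- Stability and cancellation in the field of values.

module ClosedFieldProperties {d m₁ m₂ : Level} (K : AlgebraicallyClosedField₀ d m₁ m₂) where
  open AlgebraicallyClosedField₀ K
  open RingProperties ring using ([y-z]x≈yx-zx; x≈y⇒x∙y⁻¹≈ε)
  open Multiples semiring using (×-assoc-*)

  -- By tightness, equality is the negation of apartness, and negations are ¬¬-stable. This is how
  -- facts known only under double negation are used later on.
  ≈-stable : ∀ {x y} → ¬ ¬ x ≈ y → x ≈ y
  ≈-stable ¬¬x≈y = ¬#⇒≈ λ x#y → ¬¬x≈y λ x≈y → ≈⇒¬# x≈y x#y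

  -- A `z` that merely differs from 0 need not be apart from 0, so it cannot be inverted. The
  -- conclusion is an equality, however, so `x # y` may be assumed; then `x - y` is invertible and
  -- forces `z ≈ 0#`.
  *-cancelʳ-≉0 : ∀ {x y z} → ¬ z ≈ 0# → x * z ≈ y * z → x ≈ y
  *-cancelʳ-≉0 z≉0 xz≈yz = ¬#⇒≈ λ x#y →
    z≉0 (#⇒*-cancelˡ x#y (trans ([y-z]x≈yx-zx _ _ _) (x≈y⇒x∙y⁻¹≈ε xz≈yz)))

  -- The closing argument of both orthogonality relations, where `s` is a character sum and `x` the
  -- factor it acquires under reindexing.
  fixed-by-≉1⇒≈0 : ∀ {x s} → ¬ x ≈ 1# → x * s ≈ s → s ≈ 0#
  fixed-by-≉1⇒≈0 x≉1 xs≈s = ≈-stable λ s≉0 →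
    x≉1 (*-cancelʳ-≉0 s≉0 (trans xs≈s (sym (*-identityˡ _))))

  ·ℕ-torsionFree : ∀ n {x} → suc n ·ℕ x ≈ 0# → x ≈ 0#
  ·ℕ-torsionFree n {x} nx≈0 = #⇒*-cancelˡ (characteristicZero n) (begin
    (suc n ·ℕ 1# - 0#) * x ≈⟨ *-congʳ (x-0≈x _) ⟩
    suc n ·ℕ 1# * x        ≈⟨ ×-assoc-* (suc n) 1# x ⟩
    suc n ·ℕ (1# * x)      ≈⟨ +-cong (*-identityˡ x) (×-identity n) ⟩
    suc n ·ℕ x             ≈⟨ nx≈0 ⟩
    0#                     ∎)
    where
    open ≈-Reasoning setoid
    ×-identity : ∀ n → n ·ℕ (1# * x) ≈ n ·ℕ x
    ×-identity zero    = refl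
    ×-identity (suc n) = +-cong (*-identityˡ x) (×-identity n)

-- Translation operators, common eigenfunctions and separating characters.

module Separation {c ℓ₁ ℓ₂ d m₁ m₂ : Level} {q : ℕ}
  (F : FiniteField c ℓ₁ ℓ₂ q) (K : AlgebraicallyClosedField₀ d m₁ m₂) where
  open Characters F K
  open ClosedFieldProperties K
  open K using (_+_; _*_; -_; 0#; 1#; _≈_; _·ℕ_)
  open SemiringSolver K.commutativeSemiring using (solve; _:+_; _:*_; _:=_; con)
  open RingProperties K.ring using (x∙y⁻¹≈ε⇒x≈y; -1*x≈-x; -‿distribˡ-*; //-rightDividesʳ)

  -- Functions on the multiplicative group, extended by 0 to the whole field so that every element,
  -- 0 included, acts by translation.
  record PuncturedFunction : Set (c ⊔ ℓ₁ ⊔ d ⊔ m₁) where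
    field
      _⟨_⟩    : F.Carrier → K.Carrier
      cong    : ∀ {x y} → x F.≈ y → _⟨_⟩ x ≈ _⟨_⟩ y
      0#-homo : _⟨_⟩ F.0# ≈ 0#

  open PuncturedFunction using (_⟨_⟩)

  Vanishing : PuncturedFunction → Set (c ⊔ m₁)
  Vanishing f = ∀ x → f ⟨ x ⟩ ≈ 0#

  Eigen : PuncturedFunction → F.Carrier → K.Carrier → Set (c ⊔ m₁)
  Eigen f h r = ∀ x → f ⟨ h F.* x ⟩ ≈ r * f ⟨ x ⟩

  -- (T_h + s) f, where T_h is translation by h
  shift : F.Carrier → K.Carrier → PuncturedFunction → PuncturedFunction
  shift h s f = record
    { _⟨_⟩    = λ x → f ⟨ h F.* x ⟩ + s * f ⟨ x ⟩
    ; cong    = λ x≈y → K.+-cong (f.cong (F.*-congˡ x≈y)) (K.*-congˡ (f.cong x≈y))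
    ; 0#-homo = K.trans (K.+-cong (K.trans (f.cong (F.zeroʳ h)) f.0#-homo)
        (K.trans (K.*-congˡ f.0#-homo) (K.zeroʳ s))) (K.+-identityʳ _)
    }
    where module f = PuncturedFunction f

  -- Such a property survives the passage from a function to an eigenfunction, which is built by
  -- applying factors T_h - r one after another.
  ShiftInvariant : ∀ {v} → (PuncturedFunction → Set v) → Set _
  ShiftInvariant V = ∀ h s {f} → V f → V (shift h s f)

  -- Translations commute because multiplication in the field does, so eigenspaces of T_h are
  -- preserved by every T_k + s.
  Eigen-shiftInvariant : ∀ h r → ShiftInvariant (λ f → Eigen f h r)
  Eigen-shiftInvariant h r k s {f} fh≈rf x = begin
    f ⟨ k F.* (h F.* x) ⟩ + s * f ⟨ h F.* x ⟩
      ≈⟨ K.+-cong (f.cong k[hx]≈h[kx]) (K.*-congˡ (fh≈rf x)) ⟩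
    f ⟨ h F.* (k F.* x) ⟩ + s * (r * f ⟨ x ⟩)
      ≈⟨ K.+-congʳ (fh≈rf (k F.* x)) ⟩
    r * f ⟨ k F.* x ⟩ + s * (r * f ⟨ x ⟩)
      ≈⟨ solve 4 (λ r p s t → r :* p :+ s :* (r :* t) := r :* (p :+ s :* t)) K.refl _ _ _ _ ⟩
    r * (f ⟨ k F.* x ⟩ + s * f ⟨ x ⟩) ∎
    where
    open ≈-Reasoning K.setoid
    module f = PuncturedFunction f
    k[hx]≈h[kx] : k F.* (h F.* x) F.≈ h F.* (k F.* x)
    k[hx]≈h[kx] = F.trans (F.sym (F.*-assoc k h x))
      (F.trans (F.*-congʳ (F.*-comm k h)) (F.*-assoc h k x))

  -- The monic polynomial with lower coefficients a, evaluated at T_h, applied to f.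
  monicₜ : ∀ {n} → Vector K.Carrier n → F.Carrier → PuncturedFunction → F.Carrier → K.Carrier
  monicₜ {zero}  a h f x = f ⟨ x ⟩
  monicₜ {suc n} a h f x = a zero * f ⟨ x ⟩ + monicₜ (tail a) h f (h F.* x)

  -- Division by z - r, that is p(z) = p(r) + q(z) (z - r), evaluated at T_h. The factor T_h - r is
  -- absorbed into the function to which the quotient is applied.
  monicₜ-quotient : ∀ {n} r (a : Vector K.Carrier (suc n)) h f x →
    monicₜ a h f x ≈ K.monic a r * f ⟨ x ⟩ + monicₜ (K.quotient r a) h (shift h (- r) f) x
  monicₜ-quotient {n} r a h f x = go a x
    where
    open ≈-Reasoning K.setoid
    s = - r
    g = shift h s f

    split : ∀ x → f ⟨ h F.* x ⟩ ≈ r * f ⟨ x ⟩ + g ⟨ x ⟩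
    split x = begin
      f ⟨ h F.* x ⟩                                     ≈⟨ K.+-identityˡ _ ⟨
      0# + f ⟨ h F.* x ⟩                                ≈⟨ K.+-congʳ (K.trans (K.*-congʳ (K.-‿inverseʳ r)) (K.zeroˡ (f ⟨ x ⟩))) ⟨
      (r + s) * f ⟨ x ⟩ + f ⟨ h F.* x ⟩
        ≈⟨ solve 4 (λ r s p t → (r :+ s) :* p :+ t := r :* p :+ (t :+ s :* p)) K.refl r s (f ⟨ x ⟩) (f ⟨ h F.* x ⟩) ⟩
      r * f ⟨ x ⟩ + g ⟨ x ⟩ ∎

    go : ∀ {n} (a : Vector K.Carrier (suc n)) x →
      monicₜ a h f x ≈ K.monic a r * f ⟨ x ⟩ + monicₜ (K.quotient r a) h g x
    go {zero} a x = begin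
      a zero * f ⟨ x ⟩ + f ⟨ h F.* x ⟩                  ≈⟨ K.+-congˡ (split x) ⟩
      a zero * f ⟨ x ⟩ + (r * f ⟨ x ⟩ + g ⟨ x ⟩)
        ≈⟨ solve 4 (λ a p r t → a :* p :+ (r :* p :+ t) := (a :+ r :* con 1) :* p :+ t) K.refl (a zero) (f ⟨ x ⟩) r (g ⟨ x ⟩) ⟩
      (a zero + r * 1#) * f ⟨ x ⟩ + g ⟨ x ⟩ ∎
    go {suc n} a x = begin
      a zero * f ⟨ x ⟩ + monicₜ (tail a) h f (h F.* x)   ≈⟨ K.+-congˡ (go (tail a) (h F.* x)) ⟩
      a zero * f ⟨ x ⟩ + (P * f ⟨ h F.* x ⟩ + Q)         ≈⟨ K.+-congˡ (K.+-congʳ (K.*-congˡ (split x))) ⟩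
      a zero * f ⟨ x ⟩ + (P * (r * f ⟨ x ⟩ + g ⟨ x ⟩) + Q)
        ≈⟨ solve 6 (λ a t P r d Q → a :* t :+ (P :* (r :* t :+ d) :+ Q) := (a :+ r :* P) :* t :+ (P :* d :+ Q))
             K.refl (a zero) (f ⟨ x ⟩) P r (g ⟨ x ⟩) Q ⟩
      (a zero + r * P) * f ⟨ x ⟩ + (P * g ⟨ x ⟩ + Q) ∎
      where
      P = K.monic (tail a) r
      Q = monicₜ (K.quotient r (tail a)) h g (h F.* x)

  -- For a root r of the polynomial, either (T_h - r) f vanishes and f is an eigenfunction, or it is
  -- a nonzero function annihilated by the quotient, of smaller degree. Degree 0 is impossible,
  -- since the polynomial is then 1. The alternative is not decidable, whence the double negation.
  annihilated⇒eigenfunction : ∀ {v n} (a : Vector K.Carrier n) h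
    {V : PuncturedFunction → Set v} → ShiftInvariant V →
    ∀ {f} → V f → ¬ Vanishing f → (∀ x → monicₜ a h f x ≈ 0#) →
    ¬ ¬ (∃[ g ] ∃[ r ] V g × ¬ Vanishing g × Eigen g h r)
  annihilated⇒eigenfunction {n = zero}  a h V-inv Vf f≉0 f≈0 _ = f≉0 f≈0
  annihilated⇒eigenfunction {n = suc n} a h V-inv {f} Vf f≉0 af≈0 ∄g =
    annihilated⇒eigenfunction (K.quotient r a) h V-inv (V-inv h (- r) Vf) g≉0 qg≈0 ∄g
    where
    r = K.roots a zero
    g = shift h (- r) f
    g≉0 : ¬ Vanishing g
    g≉0 g≈0 = ∄g (f , r , Vf , f≉0 , λ x →
      x∙y⁻¹≈ε⇒x≈y _ _ (K.trans (K.+-congˡ (-‿distribˡ-* r _)) (g≈0 x)))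
    qg≈0 : ∀ x → monicₜ (K.quotient r a) h g x ≈ 0#
    qg≈0 x = begin
      Q                               ≈⟨ K.+-identityˡ Q ⟨
      0# + Q                          ≈⟨ K.+-congʳ (K.trans (K.*-congʳ (K.monic-roots a zero)) (K.zeroˡ _)) ⟨
      K.monic a r * f ⟨ x ⟩ + Q       ≈⟨ monicₜ-quotient r a h f x ⟨
      monicₜ a h f x                  ≈⟨ af≈0 x ⟩
      0#                              ∎
      where
      open ≈-Reasoning K.setoid
      Q = monicₜ (K.quotient r a) h g x

  private
    m = ℕ.pred (q ℕ.!)

    x^[1+m]≈1 : ∀ {x} → ¬ x F.≈ F.0# → x F.^ suc m F.≈ F.1#
    x^[1+m]≈1 {x} x≉0 = ≡.subst (λ n → x F.^ n F.≈ F.1#)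
      (≡.sym (ℕ.suc-pred (q ℕ.!) {{q ℕ.!≢0}})) (F.x^q!≈1 x≉0)

  -- Here `suc m` is q!, and h to the power q! is 1, so this power of T_h is the identity. One
  -- polynomial thus serves for all nonzero h.
  monicₜ-xⁿ⁺¹-1 : ∀ {h} f x → ¬ h F.≈ F.0# → monicₜ (K.xⁿ⁺¹-1 m) h f x ≈ 0#
  monicₜ-xⁿ⁺¹-1 {h} f x h≉0 = begin
    - 1# * f ⟨ x ⟩ + monicₜ {m} (λ _ → 0#) h f (h F.* x)
      ≈⟨ K.+-cong (-1*x≈-x _) (power m (h F.* x)) ⟩
    - f ⟨ x ⟩ + f ⟨ h F.^ m F.* (h F.* x) ⟩
      ≈⟨ K.+-congˡ (f.cong hᵐ[hx]≈x) ⟩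
    - f ⟨ x ⟩ + f ⟨ x ⟩
      ≈⟨ K.-‿inverseˡ _ ⟩
    0# ∎
    where
    open ≈-Reasoning K.setoid
    module f = PuncturedFunction f
    hᵐ[hx]≈x : h F.^ m F.* (h F.* x) F.≈ x
    hᵐ[hx]≈x = F.trans (F.sym (F.*-assoc _ h x)) (F.trans (F.*-congʳ
      (F.trans (F.*-comm _ h) (x^[1+m]≈1 h≉0))) (F.*-identityˡ x))
    power : ∀ n x → monicₜ {n} (λ _ → 0#) h f x ≈ f ⟨ h F.^ n F.* x ⟩
    power zero    x = f.cong (F.sym (F.*-identityˡ x))
    power (suc n) x = K.trans (K.+-cong (K.zeroˡ _) (power n (h F.* x))) (K.trans (K.+-identityˡ _)
      (f.cong (F.trans (F.sym (F.*-assoc _ h x)) (F.*-congʳ (F.*-comm _ h)))))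

  -- Each eigenvalue equation, once obtained, is added to the invariant property `V`, so the search
  -- for the next eigenvalue preserves it.
  commonEigenfunction : ∀ {v n} (h : Vector F.Carrier n)
    {V : PuncturedFunction → Set v} → ShiftInvariant V → ∀ {f} → V f → ¬ Vanishing f →
    ¬ ¬ (∃[ g ] V g × ¬ Vanishing g × ∀ i → ∃[ r ] Eigen g (h i) r)
  commonEigenfunction {n = zero}  h V-inv {f} Vf f≉0 ∄g = ∄g (f , Vf , f≉0 , λ ())
  commonEigenfunction {n = suc n} h {V} V-inv {f} Vf f≉0 ∄g = eigenfunction λ (g , r , Vg , g≉0 , eigen) →
    commonEigenfunction (tail h) {λ f → V f × Eigen f (h zero) r}
      (λ k s {f} (Vf , eigen) → V-inv k s Vf , Eigen-shiftInvariant (h zero) r k s {f} eigen)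
      (Vg , eigen) g≉0
      λ (g , (Vg , eigen) , g≉0 , eigens) → ∄g (g , Vg , g≉0 , λ { zero → r , eigen ; (suc i) → eigens i })
    where
    eigenfunction : ¬ ¬ (∃[ g ] ∃[ r ] V g × ¬ Vanishing g × Eigen g (h zero) r)
    eigenfunction with h zero F.≟ F.0#
    ... | no  h≉0 = annihilated⇒eigenfunction (K.xⁿ⁺¹-1 m) (h zero) V-inv Vf f≉0
                      (λ x → monicₜ-xⁿ⁺¹-1 f x h≉0)
    -- T_0 f is constantly f(0) = 0, so every f is an eigenfunction with eigenvalue 0.
    ... | yes h≈0 = λ ∄g → ∄g (f , 0# , Vf , f≉0 , λ x → K.trans
      (K.trans (f.cong (F.trans (F.*-congʳ h≈0) (F.zeroˡ x))) f.0#-homo) (K.sym (K.zeroˡ _)))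
      where module f = PuncturedFunction f

  -- f(x) = χ(x) f(1), where χ(x) is the eigenvalue of T_x.
  eigenfunction⇒character : ∀ f → ¬ Vanishing f → (∀ i → ∃[ r ] Eigen f (F.element i) r) →
    ∃[ χ ] ∀ x → Eigen f x (⟦ χ ⟧ x)
  eigenfunction⇒character f f≉0 eigens = character χ χ-cong χ-0 χ-1 χ-* , eigen
    where
    open ≈-Reasoning K.setoid
    module f = PuncturedFunction f
    χ : F.Carrier → K.Carrier
    χ x = proj₁ (eigens (F.index x))
    χ-cong : ∀ {x y} → x F.≈ y → χ x ≈ χ y
    χ-cong x≈y = K.reflexive (≡.cong (λ i → proj₁ (eigens i)) (Inverse.to-cong F.enumeration x≈y))
    eigen : ∀ x → Eigen f x (χ x)
    eigen x y = K.trans (f.cong (F.*-congʳ (F.sym (F.element-index x)))) (proj₂ (eigens (F.index x)) y)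
    χ*f1 : ∀ x → χ x * f ⟨ F.1# ⟩ ≈ f ⟨ x ⟩
    χ*f1 x = K.trans (K.sym (eigen x F.1#)) (f.cong (F.*-identityʳ x))
    f1≉0 : ¬ f ⟨ F.1# ⟩ ≈ 0#
    f1≉0 f1≈0 = f≉0 λ x → K.trans (K.sym (χ*f1 x)) (K.trans (K.*-congˡ f1≈0) (K.zeroʳ _))
    χ-0 : χ F.0# ≈ 0#
    χ-0 = *-cancelʳ-≉0 f1≉0 (K.trans (χ*f1 _) (K.trans f.0#-homo (K.sym (K.zeroˡ _))))
    χ-1 : χ F.1# ≈ 1#
    χ-1 = *-cancelʳ-≉0 f1≉0 (K.trans (χ*f1 _) (K.sym (K.*-identityˡ _)))
    χ-* : ∀ x y → χ (x F.* y) ≈ χ x * χ y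
    χ-* x y = *-cancelʳ-≉0 f1≉0 (begin
      χ (x F.* y) * f ⟨ F.1# ⟩     ≈⟨ χ*f1 (x F.* y) ⟩
      f ⟨ x F.* y ⟩                ≈⟨ eigen x y ⟩
      χ x * f ⟨ y ⟩                ≈⟨ K.*-congˡ (χ*f1 y) ⟨
      χ x * (χ y * f ⟨ F.1# ⟩)     ≈⟨ K.*-assoc _ _ _ ⟨
      χ x * χ y * f ⟨ F.1# ⟩       ∎)

  -- The equation f = T_g e - e, written without subtraction. It is the trace of the initial
  -- function that the final eigenfunction retains, and it rules out a nonzero f fixed by T_g.
  Coboundary : F.Carrier → PuncturedFunction → Set (c ⊔ ℓ₁ ⊔ d ⊔ m₁)
  Coboundary g f = ∃[ e ] ∀ x → f ⟨ x ⟩ + e ⟨ x ⟩ ≈ e ⟨ g F.* x ⟩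

  -- T_h + s commutes with T_g, so applying it to `e` as well gives the new witness.
  Coboundary-shiftInvariant : ∀ g → ShiftInvariant (Coboundary g)
  Coboundary-shiftInvariant g h s {f} (e , f+e≈eg) = shift h s e , λ x → begin
    (f ⟨ h F.* x ⟩ + s * f ⟨ x ⟩) + (e ⟨ h F.* x ⟩ + s * e ⟨ x ⟩)
      ≈⟨ solve 5 (λ a s b c d → (a :+ s :* b) :+ (c :+ s :* d) := (a :+ c) :+ s :* (b :+ d)) K.refl _ _ _ _ _ ⟩
    (f ⟨ h F.* x ⟩ + e ⟨ h F.* x ⟩) + s * (f ⟨ x ⟩ + e ⟨ x ⟩)
      ≈⟨ K.+-cong (f+e≈eg (h F.* x)) (K.*-congˡ (f+e≈eg x)) ⟩
    e ⟨ g F.* (h F.* x) ⟩ + s * e ⟨ g F.* x ⟩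
      ≈⟨ K.+-congʳ (PuncturedFunction.cong e
           (F.trans (F.sym (F.*-assoc g h x)) (F.trans (F.*-congʳ (F.*-comm g h)) (F.*-assoc h g x)))) ⟩
    e ⟨ h F.* (g F.* x) ⟩ + s * e ⟨ g F.* x ⟩ ∎
    where open ≈-Reasoning K.setoid

  -- If f = T_g e - e is fixed by T_g, then T_gⁿ e = n f + e; take n with gⁿ = 1.
  invariantCoboundary⇒vanishing : ∀ {g} → ¬ g F.≈ F.0# → ∀ f → Coboundary g f →
    (∀ x → f ⟨ g F.* x ⟩ ≈ f ⟨ x ⟩) → Vanishing f
  invariantCoboundary⇒vanishing {g} g≉0 f (e , f+e≈eg) fg≈f x = ·ℕ-torsionFree m (begin
    suc m ·ℕ f ⟨ x ⟩                         ≈⟨ //-rightDividesʳ _ _ ⟨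
    suc m ·ℕ f ⟨ x ⟩ + e ⟨ x ⟩ K.- e ⟨ x ⟩   ≈⟨ K.+-congʳ (iterate (suc m) x) ⟨
    e ⟨ g F.^ suc m F.* x ⟩ K.- e ⟨ x ⟩      ≈⟨ K.+-congʳ (e.cong (F.trans (F.*-congʳ (x^[1+m]≈1 g≉0)) (F.*-identityˡ x))) ⟩
    e ⟨ x ⟩ K.- e ⟨ x ⟩                      ≈⟨ K.-‿inverseʳ _ ⟩
    0#                                       ∎)
    where
    open ≈-Reasoning K.setoid
    module e = PuncturedFunction e
    iterate : ∀ n x → e ⟨ g F.^ n F.* x ⟩ ≈ n ·ℕ f ⟨ x ⟩ + e ⟨ x ⟩
    iterate zero    x = K.trans (e.cong (F.*-identityˡ x)) (K.sym (K.+-identityˡ _))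
    iterate (suc n) x = begin
      e ⟨ g F.* g F.^ n F.* x ⟩          ≈⟨ e.cong (F.*-assoc g _ x) ⟩
      e ⟨ g F.* (g F.^ n F.* x) ⟩        ≈⟨ f+e≈eg (g F.^ n F.* x) ⟨
      f ⟨ g F.^ n F.* x ⟩ + e ⟨ g F.^ n F.* x ⟩ ≈⟨ K.+-cong (fixed n) (iterate n x) ⟩
      f ⟨ x ⟩ + (n ·ℕ f ⟨ x ⟩ + e ⟨ x ⟩)  ≈⟨ K.+-assoc _ _ _ ⟨
      f ⟨ x ⟩ + n ·ℕ f ⟨ x ⟩ + e ⟨ x ⟩    ∎
      where
      fixed : ∀ n → f ⟨ g F.^ n F.* x ⟩ ≈ f ⟨ x ⟩
      fixed zero    = PuncturedFunction.cong f (F.*-identityˡ x)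
      fixed (suc n) = K.trans (PuncturedFunction.cong f (F.*-assoc g _ x)) (K.trans (fg≈f _) (fixed n))

  δ₁ : PuncturedFunction
  δ₁ = record { _⟨_⟩ = δ ; cong = δ-cong ; 0#-homo = δ-0 }
    where
    δ : F.Carrier → K.Carrier
    δ x with x F.≟ F.1#
    ... | yes _ = 1#
    ... | no  _ = 0#
    δ-cong : ∀ {x y} → x F.≈ y → δ x ≈ δ y
    δ-cong {x} {y} x≈y with x F.≟ F.1# | y F.≟ F.1#
    ... | yes _   | yes _   = K.refl
    ... | yes x≈1 | no  y≉1 = contradiction (F.trans (F.sym x≈y) x≈1) y≉1
    ... | no  x≉1 | yes y≈1 = contradiction (F.trans x≈y y≈1) x≉1
    ... | no  _   | no  _   = K.refl
    δ-0 : δ F.0# ≈ 0#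
    δ-0 with F.0# F.≟ F.1#
    ... | yes 0≈1 = contradiction (F.sym 0≈1) F.1≉0
    ... | no  _   = K.refl

  δ₁-1 : δ₁ ⟨ F.1# ⟩ ≈ 1#
  δ₁-1 with F.1# F.≟ F.1#
  ... | yes _   = K.refl
  ... | no  1≉1 = contradiction F.refl 1≉1

  δ₁-≉1 : ∀ {x} → ¬ x F.≈ F.1# → δ₁ ⟨ x ⟩ ≈ 0#
  δ₁-≉1 {x} x≉1 with x F.≟ F.1#
  ... | yes x≈1 = contradiction x≈1 x≉1
  ... | no  _   = K.refl

  characters-separate : ∀ {g} → ¬ g F.≈ F.0# → ¬ g F.≈ F.1# → ¬ ¬ (∃[ χ ] ¬ ⟦ χ ⟧ g ≈ 1#)
  characters-separate {g} g≉0 g≉1 ∄χ =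
    commonEigenfunction F.element (Coboundary-shiftInvariant g) {f} (δ₁ , f+δ≈δg) f≉0
      λ (f , cob , f≉0 , eigens) → let χ , eigen = eigenfunction⇒character f f≉0 eigens in
        ∄χ (χ , λ χg≈1 → f≉0 (invariantCoboundary⇒vanishing g≉0 f cob λ x →
          K.trans (eigen g x) (K.trans (K.*-congʳ χg≈1) (K.*-identityˡ _))))
    where
    open ≈-Reasoning K.setoid
    -- This is T_g δ₁ - δ₁, a coboundary with witness `δ₁`. It does not vanish, for otherwise δ₁(1)
    -- = δ₁(g), against g ≠ 1.
    f = shift g (- 1#) δ₁
    f+δ≈δg : ∀ x → f ⟨ x ⟩ + δ₁ ⟨ x ⟩ ≈ δ₁ ⟨ g F.* x ⟩
    f+δ≈δg x = begin
      δ₁ ⟨ g F.* x ⟩ + - 1# * δ₁ ⟨ x ⟩ + δ₁ ⟨ x ⟩    ≈⟨ K.+-assoc _ _ _ ⟩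
      δ₁ ⟨ g F.* x ⟩ + (- 1# * δ₁ ⟨ x ⟩ + δ₁ ⟨ x ⟩)  ≈⟨ K.+-congˡ (K.+-congʳ (-1*x≈-x _)) ⟩
      δ₁ ⟨ g F.* x ⟩ + (- δ₁ ⟨ x ⟩ + δ₁ ⟨ x ⟩)       ≈⟨ K.+-congˡ (K.-‿inverseˡ _) ⟩
      δ₁ ⟨ g F.* x ⟩ + 0#                            ≈⟨ K.+-identityʳ _ ⟩
      δ₁ ⟨ g F.* x ⟩                                 ∎
    f≉0 : ¬ Vanishing f
    f≉0 f≈0 = K.1≉0 (begin
      1#                       ≈⟨ δ₁-1 ⟨
      δ₁ ⟨ F.1# ⟩              ≈⟨ K.+-identityˡ _ ⟨
      0# + δ₁ ⟨ F.1# ⟩         ≈⟨ K.+-congʳ (f≈0 F.1#) ⟨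
      f ⟨ F.1# ⟩ + δ₁ ⟨ F.1# ⟩ ≈⟨ f+δ≈δg F.1# ⟩
      δ₁ ⟨ g F.* F.1# ⟩        ≈⟨ PuncturedFunction.cong δ₁ (F.*-identityʳ g) ⟩
      δ₁ ⟨ g ⟩                 ≈⟨ δ₁-≉1 g≉1 ⟩
      0#                       ∎)

-- Enumerated setoids and sums over them.

strictInverse : ∀ {a₁ a₂ b₁ b₂} {S : Setoid a₁ a₂} {T : Setoid b₁ b₂} →
  let module S = Setoid S; module T = Setoid T in
  (f : S.Carrier → T.Carrier) (g : T.Carrier → S.Carrier) →
  (∀ {x y} → x S.≈ y → f x T.≈ f y) → (∀ {x y} → x T.≈ y → g x S.≈ g y) →
  (∀ y → f (g y) T.≈ y) → (∀ x → g (f x) S.≈ x) → Inverse S T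
strictInverse {S = S} {T} f g f-cong g-cong fg≈id gf≈id = record
  { to = f ; from = g ; to-cong = f-cong ; from-cong = g-cong
  ; inverse = strictlyInverseˡ⇒inverseˡ f-cong fg≈id , strictlyInverseʳ⇒inverseʳ {f⁻¹ = g} {f = f} g-cong gf≈id
  }
  where open Consequences S T

module _ {s₁ s₂ : Level} (S : Setoid s₁ s₂) where
  open Setoid S

  lookup-injective : ∀ {xs} → Unique S xs → ∀ i j → lookup xs i ≈ lookup xs j → i ≡ j
  lookup-injective (x∉xs ∷ xs!) zero    zero    _  = ≡.refl
  lookup-injective (x∉xs ∷ xs!) zero    (suc j) eq = contradiction eq (All.lookup x∉xs (∈-lookup j))
  lookup-injective (x∉xs ∷ xs!) (suc i) zero    eq = contradiction (sym eq) (All.lookup x∉xs (∈-lookup i))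
  lookup-injective (x∉xs ∷ xs!) (suc i) (suc j) eq = ≡.cong suc (lookup-injective xs! i j eq)

  -- Puts the list of characters on the same footing as the enumeration of the field, so one theory
  -- of sums covers both.
  enumeration⇒inverse : ∀ {xs} → Unique S xs → IsEnumeration S xs → Inverse S (≡.setoid (Fin (length xs)))
  enumeration⇒inverse {xs} xs! _∈xs = strictInverse position (lookup xs)
    (λ x≈y → lookup-injective xs! _ _ (trans (sym (lookup-position _)) (trans x≈y (lookup-position _))))
    (λ { ≡.refl → refl })
    (λ i → lookup-injective xs! _ i (sym (lookup-position _)))
    (λ x → sym (lookup-position x))
    where
    position : Carrier → Fin (length xs)
    position x = Any.index (x ∈xs)
    lookup-position : ∀ x → x ≈ lookup xs (position x)
    lookup-position x = lookup-index (x ∈xs)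

module FiniteSum {a ℓ : Level} (M : CommutativeMonoid a ℓ) {s₁ s₂ : Level} {S : Setoid s₁ s₂} {n : ℕ}
  (enumeration : Inverse S (≡.setoid (Fin n))) where
  open CommutativeMonoid M renaming (_∙_ to _+_; ε to 0#; ∙-congˡ to +-congˡ; identityʳ to +-identityʳ)
  open MonoidSum M using (sum; sum-remove; sum-cong-≋; sum-replicate-zero; sum-permute)
  module S = Setoid S
  open Inverse enumeration using () renaming (to to index; from to element)

  ∑ : (S.Carrier → Carrier) → Carrier
  ∑ φ = sum (λ i → φ (element i))

  element-index : ∀ x → element (index x) S.≈ x
  element-index = Inverse.strictlyInverseʳ enumeration

  module _ {φ : S.Carrier → Carrier} (φ-cong : ∀ {x y} → x S.≈ y → φ x ≈ φ y) where

    ∑-single : ∀ y → (∀ x → ¬ x S.≈ y → φ x ≈ 0#) → ∑ φ ≈ φ y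
    ∑-single y φ≈0 = trans (sum-single (λ i → φ (element i)) (index y) λ i i≢index-y →
        φ≈0 (element i) λ i≈y → i≢index-y (≡.trans (≡.sym (Inverse.strictlyInverseˡ enumeration i))
          (Inverse.to-cong enumeration i≈y)))
      (φ-cong (element-index y))
      where
      sum-single : ∀ {n} (f : Vector Carrier n) j → (∀ i → ¬ i ≡ j → f i ≈ 0#) → sum f ≈ f j
      sum-single {suc n} f j f≈0 = trans (sum-remove {i = j} f) (trans (+-congˡ (trans
        (sum-cong-≋ λ i → f≈0 (punchIn j i) (punchInᵢ≢i j i)) (sum-replicate-zero n))) (+-identityʳ _))

    -- Conjugating `σ` by the enumeration gives a permutation of `Fin n`, under which a sum is
    -- invariant.
    ∑-reindex : (σ : Inverse S S) → ∑ φ ≈ ∑ (φ ∘ Inverse.to σ)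
    ∑-reindex σ = trans (sum-permute (λ i → φ (element i))
        (Composition.inverse (Symmetry.inverse enumeration) (Composition.inverse σ enumeration)))
      (sum-cong-≋ {n = n} λ i → φ-cong (element-index (Inverse.to σ (element i))))

-- Inversion and reflection as permutations of the finite field.

module FieldInverse {c ℓ₁ ℓ₂ : Level} {q : ℕ} (F : FiniteField c ℓ₁ ℓ₂ q) where
  open FiniteField F
  open RingProperties ring using (⁻¹-anti-homo‿-; x∙y⁻¹≈ε⇒x≈y; xyx⁻¹≈y)
  open ≈-Reasoning setoid

  ⁻¹-inverseˡ : ∀ {x} → ¬ x ≈ 0# → x ⁻¹ * x ≈ 1#
  ⁻¹-inverseˡ x≉0 = trans (*-comm _ _) (⁻¹-inverseʳ x≉0)

  ⁻¹-unique : ∀ {x y} → x * y ≈ 1# → y ≈ x ⁻¹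
  ⁻¹-unique {x} {y} xy≈1 = *-cancelˡ-nonZero x≉0 (trans xy≈1 (sym (⁻¹-inverseʳ x≉0)))
    where
    x≉0 : ¬ x ≈ 0#
    x≉0 x≈0 = 1≉0 (trans (sym xy≈1) (trans (*-congʳ x≈0) (zeroˡ y)))

  ⁻¹-nonZero : ∀ {x} → ¬ x ≈ 0# → ¬ x ⁻¹ ≈ 0#
  ⁻¹-nonZero x≉0 x⁻¹≈0 = 1≉0 (trans (sym (⁻¹-inverseʳ x≉0)) (trans (*-congˡ x⁻¹≈0) (zeroʳ _)))

  ⁻¹-involutive : ∀ x → (x ⁻¹) ⁻¹ ≈ x
  ⁻¹-involutive x with x ≟ 0#
  ... | yes x≈0 = trans (0⁻¹≈0 (0⁻¹≈0 x≈0)) (sym x≈0)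
  ... | no  x≉0 = sym (⁻¹-unique (⁻¹-inverseˡ x≉0))

  -- The convention that 0 is its own inverse makes inversion a permutation of the whole field, so
  -- sums can be reindexed without an exception at 0.
  ⁻¹-inverse : Inverse setoid setoid
  ⁻¹-inverse = strictInverse _⁻¹ _⁻¹ ⁻¹-cong ⁻¹-cong ⁻¹-involutive ⁻¹-involutive

  1-[1-x]≈x : ∀ x → 1# - (1# - x) ≈ x
  1-[1-x]≈x x = begin
    1# - (1# - x)    ≈⟨ +-congˡ (⁻¹-anti-homo‿- 1# x) ⟩
    1# + (x - 1#)    ≈⟨ +-comm _ _ ⟩
    x - 1# + 1#      ≈⟨ +-assoc _ _ _ ⟩
    x + (- 1# + 1#)  ≈⟨ +-congˡ (-‿inverseˡ 1#) ⟩
    x + 0#           ≈⟨ +-identityʳ x ⟩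
    x                ∎

  1-x-cong : ∀ {x y} → x ≈ y → 1# - x ≈ 1# - y
  1-x-cong x≈y = +-congˡ (-‿cong x≈y)

  1-x-inverse : Inverse setoid setoid
  1-x-inverse = strictInverse (λ x → 1# - x) (λ x → 1# - x) 1-x-cong 1-x-cong 1-[1-x]≈x 1-[1-x]≈x

  1-x≈0 : ∀ {x} → x ≈ 1# → 1# - x ≈ 0#
  1-x≈0 x≈1 = trans (1-x-cong x≈1) (-‿inverseʳ 1#)

  1-x≈1 : ∀ {x} → x ≈ 0# → 1# - x ≈ 1#
  1-x≈1 x≈0 = trans (1-x-cong (trans x≈0 (sym (-‿inverseʳ 1#)))) (1-[1-x]≈x 1#)

  1-x≉0 : ∀ {x} → ¬ x ≈ 1# → ¬ 1# - x ≈ 0#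
  1-x≉0 x≉1 1-x≈0 = x≉1 (sym (x∙y⁻¹≈ε⇒x≈y _ _ 1-x≈0))

  x+[1-x]≈1 : ∀ x → x + (1# - x) ≈ 1#
  x+[1-x]≈1 x = trans (sym (+-assoc x 1# (- x))) (xyx⁻¹≈y x 1#)

  *-inverse : ∀ {x} → ¬ x ≈ 0# → Inverse setoid setoid
  *-inverse {x} x≉0 = strictInverse (x *_) (x ⁻¹ *_) *-congˡ *-congˡ
    (λ y → cancel (⁻¹-inverseʳ x≉0)) (λ y → cancel (⁻¹-inverseˡ x≉0))
    where
    cancel : ∀ {x y z} → x * y ≈ 1# → x * (y * z) ≈ z
    cancel xy≈1 = trans (sym (*-assoc _ _ _)) (trans (*-congʳ xy≈1) (*-identityˡ _))

-- Orthogonality relations and the number of characters.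

module Orthogonality {c ℓ₁ ℓ₂ d m₁ m₂ : Level} {q : ℕ}
  (F : FiniteField c ℓ₁ ℓ₂ q) (K : AlgebraicallyClosedField₀ d m₁ m₂) where
  open Characters F K
  open ClosedFieldProperties K
  open Separation F K using (characters-separate)
  open FieldInverse F
  open K using (_+_; _*_; 0#; 1#; _≈_; _·ℕ_)
  open Summation K.semiring using (∑-comm; ∑-distrib-+; *-distribˡ-sum; *-distribʳ-sum; sum-cong-≋; sum-replicate; sum-replicate-zero)
  open RingProperties K.ring using (+-cancelʳ)
  module ∑F = FiniteSum K.+-commutativeMonoid F.enumeration
  module ∑C = FiniteSum K.+-commutativeMonoid
    (enumeration⇒inverse characterSetoid characters-unique characters-enumerates)

  ∑ᶠ-cong : ∀ {φ ψ : F.Carrier → K.Carrier} → (∀ x → φ x ≈ ψ x) → ∑ᶠ φ ≈ ∑ᶠ ψ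
  ∑ᶠ-cong φ≈ψ = sum-cong-≋ {n = q} λ i → φ≈ψ (F.element i)

  ∑ᶜ-cong : ∀ {φ ψ : Character → K.Carrier} → (∀ x → φ x ≈ ψ x) → ∑ᶜ φ ≈ ∑ᶜ ψ
  ∑ᶜ-cong φ≈ψ = sum-cong-≋ {n = length characters} λ i → φ≈ψ (lookup characters i)

  *-distribˡ-∑ᶠ : ∀ z (φ : F.Carrier → K.Carrier) → z * ∑ᶠ φ ≈ ∑ᶠ[ x ] (z * φ x)
  *-distribˡ-∑ᶠ z φ = *-distribˡ-sum z (λ i → φ (F.element i))

  *-distribʳ-∑ᶠ : ∀ z (φ : F.Carrier → K.Carrier) → ∑ᶠ φ * z ≈ ∑ᶠ[ x ] (φ x * z)
  *-distribʳ-∑ᶠ z φ = *-distribʳ-sum z (λ i → φ (F.element i))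

  *-distribˡ-∑ᶜ : ∀ z (φ : Character → K.Carrier) → z * ∑ᶜ φ ≈ ∑ᶜ[ χ ] (z * φ χ)
  *-distribˡ-∑ᶜ z φ = *-distribˡ-sum z (λ i → φ (lookup characters i))

  ∑ᶜ-∑ᶠ-comm : ∀ (φ : Character → F.Carrier → K.Carrier) → ∑ᶜ[ χ ] ∑ᶠ[ x ] φ χ x ≈ ∑ᶠ[ x ] ∑ᶜ[ χ ] φ χ x
  ∑ᶜ-∑ᶠ-comm φ = ∑-comm (λ i j → φ (lookup characters i) (F.element j))

  ∑ᶜ-0 : ∀ {φ : Character → K.Carrier} → (∀ χ → φ χ ≈ 0#) → ∑ᶜ φ ≈ 0#
  ∑ᶜ-0 φ≈0 = K.trans (∑ᶜ-cong φ≈0) (sum-replicate-zero (length characters))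

  ε-≉0 : ∀ {x} → ¬ x F.≈ F.0# → ⟦ ε ⟧ x ≈ 1#
  ε-≉0 {x} x≉0 with x F.≟ F.0#
  ... | yes x≈0 = contradiction x≈0 x≉0
  ... | no  _   = K.refl

  χ-0 : ∀ χ {x} → x F.≈ F.0# → ⟦ χ ⟧ x ≈ 0#
  χ-0 χ x≈0 = K.trans (Character.⟦⟧-cong χ x≈0) (Character.0#-homo χ)

  χ-1 : ∀ χ {x} → x F.≈ F.1# → ⟦ χ ⟧ x ≈ 1#
  χ-1 χ x≈1 = K.trans (Character.⟦⟧-cong χ x≈1) (Character.1#-homo χ)

  -- Reindexing by y ↦ x y shows χ(x) S = S for the sum S and every x ≠ 0. If S were nonzero, all
  -- these χ(x) would be 1 and χ would be trivial.
  ∑ᶠ-nontrivial : ∀ χ → ¬ χ ≈ᶜ ε → ∑ᶠ ⟦ χ ⟧ ≈ 0#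
  ∑ᶠ-nontrivial χ χ≉ε = ≈-stable λ S≉0 → χ≉ε λ x → χ≈ε S≉0 x
    where
    open ≈-Reasoning K.setoid
    χ*S≈S : ∀ {x} → ¬ x F.≈ F.0# → ⟦ χ ⟧ x * ∑ᶠ ⟦ χ ⟧ ≈ ∑ᶠ ⟦ χ ⟧
    χ*S≈S {x} x≉0 = begin
      ⟦ χ ⟧ x * ∑ᶠ ⟦ χ ⟧                  ≈⟨ *-distribˡ-∑ᶠ (⟦ χ ⟧ x) ⟦ χ ⟧ ⟩
      ∑ᶠ[ y ] (⟦ χ ⟧ x * ⟦ χ ⟧ y)         ≈⟨ ∑ᶠ-cong (Character.*-homo χ x) ⟨
      ∑ᶠ[ y ] ⟦ χ ⟧ (x F.* y)             ≈⟨ ∑F.∑-reindex (Character.⟦⟧-cong χ) (*-inverse x≉0) ⟨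
      ∑ᶠ ⟦ χ ⟧                            ∎
    χ≈ε : ¬ ∑ᶠ ⟦ χ ⟧ ≈ 0# → ∀ x → ⟦ χ ⟧ x ≈ ⟦ ε ⟧ x
    χ≈ε S≉0 x with x F.≟ F.0#
    ... | yes x≈0 = χ-0 χ x≈0
    ... | no  x≉0 = ≈-stable λ χx≉1 → S≉0 (fixed-by-≉1⇒≈0 χx≉1 (χ*S≈S x≉0))

  χ⁻-inverseˡ : ∀ χ {x} → ¬ x F.≈ F.0# → ⟦ χ ⁻ ⟧ x * ⟦ χ ⟧ x ≈ 1#
  χ⁻-inverseˡ χ x≉0 = K.trans (K.sym (Character.*-homo χ _ _)) (χ-1 χ (⁻¹-inverseˡ x≉0))

  ·-inverse : Character → Inverse characterSetoid characterSetoid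
  ·-inverse ψ = strictInverse (ψ ·_) (ψ ⁻ ·_)
    (λ χ≈χ′ x → K.*-congˡ (χ≈χ′ x)) (λ χ≈χ′ x → K.*-congˡ (χ≈χ′ x))
    (λ χ x → cancel χ x λ x≉0 → K.trans (K.*-comm _ _) (χ⁻-inverseˡ ψ x≉0))
    (λ χ x → cancel χ x λ x≉0 → χ⁻-inverseˡ ψ x≉0)
    where
    cancel : ∀ χ x {a b} → (¬ x F.≈ F.0# → a * b ≈ 1#) → a * (b * ⟦ χ ⟧ x) ≈ ⟦ χ ⟧ x
    cancel χ x ab≈1 with x F.≟ F.0#
    -- At 0 the two factors do not multiply to 1, but both sides vanish with χ(0).
    ... | yes x≈0 = K.trans (K.*-congˡ (K.trans (K.*-congˡ (χ-0 χ x≈0)) (K.zeroʳ _)))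
                      (K.trans (K.zeroʳ _) (K.sym (χ-0 χ x≈0)))
    ... | no  x≉0 = K.trans (K.sym (K.*-assoc _ _ _)) (K.trans (K.*-congʳ (ab≈1 x≉0)) (K.*-identityˡ _))

  -- For g ≠ 0, multiplying all characters by a `ψ` with ψ(g) ≠ 1 permutes them and multiplies the
  -- sum by ψ(g). Such a `ψ` is available only under double negation, which suffices for an
  -- equality. For g = 0 every term is 0.
  ∑ᶜ-≉1 : ∀ {g} → ¬ g F.≈ F.1# → ∑ᶜ[ χ ] ⟦ χ ⟧ g ≈ 0#
  ∑ᶜ-≉1 {g} g≉1 with g F.≟ F.0#
  ... | yes g≈0 = ∑ᶜ-0 λ χ → χ-0 χ g≈0
  ... | no  g≉0 = ≈-stable λ S≉0 → characters-separate g≉0 g≉1 λ (ψ , ψg≉1) →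
    S≉0 (fixed-by-≉1⇒≈0 ψg≉1 (begin
      ⟦ ψ ⟧ g * (∑ᶜ[ χ ] ⟦ χ ⟧ g)    ≈⟨ *-distribˡ-∑ᶜ (⟦ ψ ⟧ g) (λ χ → ⟦ χ ⟧ g) ⟩
      ∑ᶜ[ χ ] ⟦ ψ · χ ⟧ g            ≈⟨ ∑C.∑-reindex {φ = λ χ → ⟦ χ ⟧ g} (λ χ≈χ′ → χ≈χ′ g) (·-inverse ψ) ⟨
      ∑ᶜ[ χ ] ⟦ χ ⟧ g                ∎))
    where open ≈-Reasoning K.setoid

  -- Both sides are Σ_χ Σ_x χ(x).
  ∑ᶜ-1≈∑ᶠ-ε : ∑ᶜ[ χ ] ⟦ χ ⟧ F.1# ≈ ∑ᶠ ⟦ ε ⟧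
  ∑ᶜ-1≈∑ᶠ-ε = begin
    ∑ᶜ[ χ ] ⟦ χ ⟧ F.1#          ≈⟨ ∑F.∑-single {φ = λ x → ∑ᶜ[ χ ] ⟦ χ ⟧ x}
                                     (λ x≈y → ∑ᶜ-cong λ χ → Character.⟦⟧-cong χ x≈y) F.1# (λ x → ∑ᶜ-≉1) ⟨
    ∑ᶠ[ x ] ∑ᶜ[ χ ] ⟦ χ ⟧ x     ≈⟨ ∑ᶜ-∑ᶠ-comm ⟦_⟧ ⟨
    ∑ᶜ[ χ ] ∑ᶠ ⟦ χ ⟧            ≈⟨ ∑C.∑-single {φ = λ χ → ∑ᶠ ⟦ χ ⟧} (λ χ≈ψ → ∑ᶠ-cong χ≈ψ) ε ∑ᶠ-nontrivial ⟩
    ∑ᶠ ⟦ ε ⟧                    ∎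
    where open ≈-Reasoning K.setoid

  -- The function 1 - ε is the indicator of 0 and accounts for the added 1. This form avoids
  -- truncated subtraction from `q`.
  ∑ᶠ-ε+1 : ∑ᶠ ⟦ ε ⟧ + 1# ≈ q ·ℕ 1#
  ∑ᶠ-ε+1 = begin
    ∑ᶠ ⟦ ε ⟧ + 1#                        ≈⟨ K.+-congˡ (K.trans (∑F.∑-single δ-cong F.0# (λ x → δ-≉0)) δ-0) ⟨
    ∑ᶠ ⟦ ε ⟧ + ∑ᶠ δ            ≈⟨ ∑-distrib-+ (λ i → ⟦ ε ⟧ (F.element i)) (λ i → δ (F.element i)) ⟨
    ∑ᶠ[ x ] (⟦ ε ⟧ x + δ x)              ≈⟨ ∑ᶠ-cong ε+δ≈1 ⟩
    ∑ᶠ[ x ] 1#                           ≈⟨ sum-replicate q ⟩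
    q ·ℕ 1#                              ∎
    where
    open ≈-Reasoning K.setoid
    δ : F.Carrier → K.Carrier
    δ x = 1# K.- ⟦ ε ⟧ x
    δ-cong : ∀ {x y} → x F.≈ y → δ x ≈ δ y
    δ-cong x≈y = K.+-congˡ (K.-‿cong (Character.⟦⟧-cong ε x≈y))
    δ-≉0 : ∀ {x} → ¬ x F.≈ F.0# → δ x ≈ 0#
    δ-≉0 x≉0 = K.trans (K.+-congˡ (K.-‿cong (ε-≉0 x≉0))) (K.-‿inverseʳ 1#)
    δ-0 : δ F.0# ≈ 1#
    δ-0 = K.trans (K.+-congˡ (K.-‿cong (Character.0#-homo ε))) (K.x-0≈x 1#)
    ε+δ≈1 : ∀ x → ⟦ ε ⟧ x + δ x ≈ 1#
    ε+δ≈1 x = K.sym (K.x≈y+[x-y] 1# (⟦ ε ⟧ x))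

  reciprocal-inverse : K.reciprocal (q ℕ.∸ 1) * ∑ᶠ ⟦ ε ⟧ ≈ 1#
  -- The distinct indices of 1 and 0 show that q is at least 2, so that `reciprocal` is not taken at
  -- its default value at 0.
  reciprocal-inverse = go (F.index F.1#) (F.index F.0#) index-1≢index-0 ∑ᶠ-ε+1
    where
    open ≈-Reasoning K.setoid
    index-1≢index-0 : ¬ F.index F.1# ≡ F.index F.0#
    index-1≢index-0 eq = F.1≉0 (F.trans (F.sym (F.element-index _))
      (F.trans (F.reflexive (≡.cong F.element eq)) (F.element-index _)))
    go : ∀ {n} (i j : Fin n) → ¬ i ≡ j → ∀ {s} → s + 1# ≈ n ·ℕ 1# → K.reciprocal (n ℕ.∸ 1) * s ≈ 1#
    go {suc zero}    zero zero i≢j _ = contradiction ≡.refl i≢j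
    go {suc (suc n)} i    j    _   {s} s+1≈n = begin
      K.reciprocal (suc n) * s                         ≈⟨ K.*-congˡ (+-cancelʳ 1# _ _ (K.trans s+1≈n (K.+-comm _ _))) ⟩
      K.reciprocal (suc n) * (suc n ·ℕ 1#)             ≈⟨ K.*-congˡ (K.x-0≈x _) ⟨
      K.reciprocal (suc n) * (suc n ·ℕ 1# K.- 0#)      ≈⟨ proj₁ (proj₂ (K.#⇒invertible (K.characteristicZero n))) ⟩
      1#                                               ∎

  average-1 : ∀ {g} → g F.≈ F.1# → K.reciprocal (q ℕ.∸ 1) * (∑ᶜ[ χ ] ⟦ χ ⟧ g) ≈ 1#
  average-1 g≈1 = K.trans (K.*-congˡ (K.trans (∑ᶜ-cong λ χ → Character.⟦⟧-cong χ g≈1) ∑ᶜ-1≈∑ᶠ-ε)) reciprocal-inverse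

  average-≉1 : ∀ {g} → ¬ g F.≈ F.1# → K.reciprocal (q ℕ.∸ 1) * (∑ᶜ[ χ ] ⟦ χ ⟧ g) ≈ 0#
  average-≉1 g≉1 = K.trans (K.*-congˡ (∑ᶜ-≉1 g≉1)) (K.zeroʳ _)

-- Jacobi sum expansions and the binomial theorem.

module HypergeometricSums {c ℓ₁ ℓ₂ d m₁ m₂ : Level} {q : ℕ}
  (F : FiniteField c ℓ₁ ℓ₂ q) (K : AlgebraicallyClosedField₀ d m₁ m₂) where
  open Characters F K
  open FieldInverse F
  open Orthogonality F K
  open K using (_+_; _*_; 0#; 1#; _≈_)
  open CommutativeSemigroupProperties K.*-commutativeSemigroup using (x∙yz≈y∙xz)
  open MonoidSolver K.*-commutativeMonoid using (solve; _⊕_; _⊜_)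
  open RingProperties F.ring using (-1*x≈-x; -0#≈0#; -‿distribˡ-*; -‿involutive; x[y-z]≈xy-xz; xyx⁻¹≈y)

  *-zeroˡ : ∀ {x y} → x ≈ 0# → x * y ≈ 0#
  *-zeroˡ x≈0 = K.trans (K.*-congʳ x≈0) (K.zeroˡ _)

  *-zeroʳ : ∀ {x y} → y ≈ 0# → x * y ≈ 0#
  *-zeroʳ y≈0 = K.trans (K.*-congˡ y≈0) (K.zeroʳ _)

  -1*-1≈1 : -1ᶠ F.* -1ᶠ F.≈ F.1#
  -1*-1≈1 = F.trans (-1*x≈-x -1ᶠ) (-‿involutive F.1#)

  -1⁻¹≈-1 : -1ᶠ F.⁻¹ F.≈ -1ᶠ
  -1⁻¹≈-1 = F.sym (⁻¹-unique -1*-1≈1)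

  -1≉0 : ¬ -1ᶠ F.≈ F.0#
  -1≉0 -1≈0 = F.1≉0 (F.trans (F.sym -1*-1≈1) (F.trans (F.*-congʳ -1≈0) (F.zeroˡ _)))

  -- The involution u ↦ u / (u - 1) of F ∖ {1}, with 1 sent to 0.
  ω : F.Carrier → F.Carrier
  ω t = -1ᶠ F.* (t F./ (F.1# F.- t))

  ω-cong : ∀ {s t} → s F.≈ t → ω s F.≈ ω t
  ω-cong s≈t = F.*-congˡ (F.*-cong s≈t (F.⁻¹-cong (1-x-cong s≈t)))

  ω-nonZero : ∀ {t} → ¬ t F.≈ F.0# → ¬ t F.≈ F.1# → ¬ ω t F.≈ F.0#
  ω-nonZero t≉0 t≉1 = F.*-nonZero -1≉0 (F.*-nonZero t≉0 (⁻¹-nonZero (1-x≉0 t≉1)))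

  ω*[1-t]≈-t : ∀ {t} → ¬ t F.≈ F.1# → ω t F.* (F.1# F.- t) F.≈ F.- t
  ω*[1-t]≈-t {t} t≉1 = begin
    -1ᶠ F.* (t F./ (F.1# F.- t)) F.* (F.1# F.- t)    ≈⟨ F.*-assoc _ _ _ ⟩
    -1ᶠ F.* (t F./ (F.1# F.- t) F.* (F.1# F.- t))    ≈⟨ F.*-congˡ (F.*-assoc _ _ _) ⟩
    -1ᶠ F.* (t F.* ((F.1# F.- t) F.⁻¹ F.* (F.1# F.- t)))  ≈⟨ F.*-congˡ (F.*-congˡ (⁻¹-inverseˡ (1-x≉0 t≉1))) ⟩
    -1ᶠ F.* (t F.* F.1#)                             ≈⟨ F.*-congˡ (F.*-identityʳ t) ⟩
    -1ᶠ F.* t                                        ≈⟨ -1*x≈-x t ⟩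
    F.- t                                            ∎
    where open ≈-Reasoning F.setoid

  1-[1-t]⁻¹≈ω : ∀ {t} → ¬ t F.≈ F.1# → F.1# F.- (F.1# F.- t) F.⁻¹ F.≈ ω t
  1-[1-t]⁻¹≈ω {t} t≉1 = F.*-cancelˡ-nonZero (1-x≉0 t≉1) (begin
    D F.* (F.1# F.- D F.⁻¹)               ≈⟨ x[y-z]≈xy-xz D F.1# (D F.⁻¹) ⟩
    D F.* F.1# F.- D F.* D F.⁻¹           ≈⟨ F.+-cong (F.*-identityʳ D) (F.-‿cong (F.⁻¹-inverseʳ (1-x≉0 t≉1))) ⟩
    F.1# F.- t F.- F.1#                   ≈⟨ xyx⁻¹≈y F.1# (F.- t) ⟩
    F.- t                                 ≈⟨ ω*[1-t]≈-t t≉1 ⟨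
    ω t F.* D                             ≈⟨ F.*-comm _ D ⟩
    D F.* ω t                             ∎)
    where
    open ≈-Reasoning F.setoid
    D = F.1# F.- t

  1-w⁻¹≈ω⁻¹ : ∀ {w} → ¬ w F.≈ F.0# → ¬ w F.≈ F.1# → F.1# F.- w F.⁻¹ F.≈ ω w F.⁻¹
  1-w⁻¹≈ω⁻¹ {w} w≉0 w≉1 = ⁻¹-unique (F.*-cancelˡ-nonZero (1-x≉0 w≉1) (begin
    D F.* (ω w F.* (F.1# F.- w F.⁻¹))     ≈⟨ F.*-assoc _ _ _ ⟨
    D F.* ω w F.* (F.1# F.- w F.⁻¹)       ≈⟨ F.*-congʳ (F.trans (F.*-comm _ _) (ω*[1-t]≈-t w≉1)) ⟩
    F.- w F.* (F.1# F.- w F.⁻¹)           ≈⟨ x[y-z]≈xy-xz (F.- w) F.1# (w F.⁻¹) ⟩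
    F.- w F.* F.1# F.- F.- w F.* w F.⁻¹   ≈⟨ F.+-cong (F.*-identityʳ _) (F.-‿cong (F.sym (-‿distribˡ-* w _))) ⟩
    F.- w F.- F.- (w F.* w F.⁻¹)          ≈⟨ F.+-congˡ (-‿involutive _) ⟩
    F.- w F.+ w F.* w F.⁻¹                ≈⟨ F.+-congˡ (F.⁻¹-inverseʳ w≉0) ⟩
    F.- w F.+ F.1#                        ≈⟨ F.+-comm _ _ ⟩
    D                                     ≈⟨ F.*-identityʳ D ⟨
    D F.* F.1#                            ∎))
    where
    open ≈-Reasoning F.setoid
    D = F.1# F.- w

  χ-ω : ∀ χ t → ⟦ χ ⟧ (ω t) ≈ ⟦ χ ⟧ -1ᶠ * (⟦ χ ⟧ t * ⟦ χ ⟧ ((F.1# F.- t) F.⁻¹))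
  χ-ω χ t = K.trans (Character.*-homo χ _ _) (K.*-congˡ (Character.*-homo χ _ _))

  -- The three occurrences χ(-1), χ(s) and the inverse of χ at 1 - s combine into the single value
  -- χ(ω(s)), which prepares the sum over χ for orthogonality.
  binomial-·χ-χ : ∀ A χ → binomial (A · χ) χ ≈ ∑ᶠ[ s ] (⟦ A ⟧ s * ⟦ χ ⟧ (ω s))
  binomial-·χ-χ A χ = K.trans (*-distribˡ-∑ᶠ _ λ s → ⟦ A · χ ⟧ s * ⟦ χ ⁻ ⟧ (F.1# F.- s)) (∑ᶠ-cong λ s → begin
    ⟦ χ ⟧ -1ᶠ * (⟦ A ⟧ s * ⟦ χ ⟧ s * ⟦ χ ⁻ ⟧ (F.1# F.- s))
      ≈⟨ solve 4 (λ n a s s′ → n ⊕ ((a ⊕ s) ⊕ s′) ⊜ a ⊕ (n ⊕ (s ⊕ s′))) K.refl _ _ _ _ ⟩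
    ⟦ A ⟧ s * (⟦ χ ⟧ -1ᶠ * (⟦ χ ⟧ s * ⟦ χ ⁻ ⟧ (F.1# F.- s)))
      ≈⟨ K.*-congˡ (χ-ω χ s) ⟨
    ⟦ A ⟧ s * ⟦ χ ⟧ (ω s) ∎)
    where
    open ≈-Reasoning K.setoid

  -- The term at `t` of the Jacobi sum expansion of `binomial P Q`.
  weight : Character → Character → F.Carrier → K.Carrier
  weight P Q t = ⟦ Q ⟧ -1ᶠ * (⟦ P ⟧ t * ⟦ Q ⁻ ⟧ (F.1# F.- t))

  weight-0 : ∀ P Q {t} → t F.≈ F.0# → weight P Q t ≈ 0#
  weight-0 P Q t≈0 = *-zeroʳ (*-zeroˡ (χ-0 P t≈0))

  weight-1 : ∀ P Q {t} → t F.≈ F.1# → weight P Q t ≈ 0#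
  weight-1 P Q t≈1 = *-zeroʳ (*-zeroʳ (χ-0 (Q ⁻) (1-x≈0 t≈1)))

  binomial-·χ-·χ : ∀ P Q χ → binomial (P · χ) (Q · χ) ≈ ∑ᶠ[ t ] (weight P Q t * ⟦ χ ⟧ (ω t))
  binomial-·χ-·χ P Q χ = K.trans (*-distribˡ-∑ᶠ _ λ t → ⟦ P · χ ⟧ t * ⟦ (Q · χ) ⁻ ⟧ (F.1# F.- t)) (∑ᶠ-cong λ t → begin
    ⟦ Q ⟧ -1ᶠ * ⟦ χ ⟧ -1ᶠ * (⟦ P ⟧ t * ⟦ χ ⟧ t * (⟦ Q ⁻ ⟧ (F.1# F.- t) * ⟦ χ ⁻ ⟧ (F.1# F.- t)))
      ≈⟨ solve 6 (λ m n p s q s′ → (m ⊕ n) ⊕ ((p ⊕ s) ⊕ (q ⊕ s′)) ⊜ (m ⊕ (p ⊕ q)) ⊕ (n ⊕ (s ⊕ s′))) K.refl _ _ _ _ _ _ ⟩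
    weight P Q t * (⟦ χ ⟧ -1ᶠ * (⟦ χ ⟧ t * ⟦ χ ⁻ ⟧ (F.1# F.- t)))
      ≈⟨ K.*-congˡ (χ-ω χ t) ⟨
    weight P Q t * ⟦ χ ⟧ (ω t) ∎)
    where
    open ≈-Reasoning K.setoid

  mean : (Character → K.Carrier) → K.Carrier
  mean φ = K.reciprocal (q ℕ.∸ 1) * ∑ᶜ φ

  mean-cong : ∀ φ ψ → (∀ χ → φ χ ≈ ψ χ) → mean φ ≈ mean ψ
  mean-cong φ ψ φ≈ψ = K.*-congˡ (∑ᶜ-cong {φ} {ψ} φ≈ψ)

  mean-∑ᶠ : ∀ (φ : Character → F.Carrier → K.Carrier) →
    mean (λ χ → ∑ᶠ[ s ] φ χ s) ≈ ∑ᶠ[ s ] mean (λ χ → φ χ s)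
  mean-∑ᶠ φ = K.trans (K.*-congˡ (∑ᶜ-∑ᶠ-comm φ)) (*-distribˡ-∑ᶠ _ λ s → ∑ᶜ[ χ ] φ χ s)

  mean-*ˡ : ∀ z φ → mean (λ χ → z * φ χ) ≈ z * mean φ
  mean-*ˡ z φ = K.trans (K.*-congˡ (K.sym (*-distribˡ-∑ᶜ z φ))) (x∙yz≈y∙xz _ z (∑ᶜ φ))

  ₁F₀ : Character → F.Carrier → K.Carrier
  ₁F₀ A y = mean λ χ → binomial (A · χ) χ * ⟦ χ ⟧ y

  -- Brings the average over χ innermost, where it detects whether ω(s) y = 1.
  ₁F₀-mean : ∀ A y → ₁F₀ A y ≈ ∑ᶠ[ s ] (⟦ A ⟧ s * mean (λ χ → ⟦ χ ⟧ (ω s F.* y)))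
  ₁F₀-mean A y = begin
    mean (λ χ → binomial (A · χ) χ * ⟦ χ ⟧ y)
      ≈⟨ mean-cong _ _ expand ⟩
    mean (λ χ → ∑ᶠ[ s ] (⟦ A ⟧ s * ⟦ χ ⟧ (ω s F.* y)))
      ≈⟨ mean-∑ᶠ (λ χ s → ⟦ A ⟧ s * ⟦ χ ⟧ (ω s F.* y)) ⟩
    ∑ᶠ[ s ] mean (λ χ → ⟦ A ⟧ s * ⟦ χ ⟧ (ω s F.* y))
      ≈⟨ ∑ᶠ-cong (λ s → mean-*ˡ (⟦ A ⟧ s) λ χ → ⟦ χ ⟧ (ω s F.* y)) ⟩
    ∑ᶠ[ s ] (⟦ A ⟧ s * mean (λ χ → ⟦ χ ⟧ (ω s F.* y))) ∎
    where
    open ≈-Reasoning K.setoid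
    expand : ∀ χ → binomial (A · χ) χ * ⟦ χ ⟧ y ≈ ∑ᶠ[ s ] (⟦ A ⟧ s * ⟦ χ ⟧ (ω s F.* y))
    expand χ = K.trans (K.*-congʳ (binomial-·χ-χ A χ)) (K.trans
      (*-distribʳ-∑ᶠ (⟦ χ ⟧ y) λ s → ⟦ A ⟧ s * ⟦ χ ⟧ (ω s))
      (∑ᶠ-cong λ s → K.trans (K.*-assoc (⟦ A ⟧ s) _ _) (K.*-congˡ (K.sym (Character.*-homo χ (ω s) y)))))

  private
    s[1-y]≈s-sy : ∀ s y → s F.* (F.1# F.- y) F.≈ s F.- s F.* y
    s[1-y]≈s-sy s y = F.trans (x[y-z]≈xy-xz s F.1# y) (F.+-congʳ (F.*-identityʳ s))

  -- ω(s) y = 1 means - s y = 1 - s.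
  ω*y≈1⇒s≈[1-y]⁻¹ : ∀ {s y} → ω s F.* y F.≈ F.1# → s F.≈ (F.1# F.- y) F.⁻¹
  ω*y≈1⇒s≈[1-y]⁻¹ {s} {y} ωy≈1 = ⁻¹-unique (begin
    (F.1# F.- y) F.* s          ≈⟨ F.*-comm _ s ⟩
    s F.* (F.1# F.- y)          ≈⟨ s[1-y]≈s-sy s y ⟩
    s F.- s F.* y               ≈⟨ F.+-congˡ (-‿distribˡ-* s y) ⟩
    s F.+ F.- s F.* y           ≈⟨ F.+-congˡ (F.*-congʳ (ω*[1-t]≈-t s≉1)) ⟨
    s F.+ ω s F.* (F.1# F.- s) F.* y  ≈⟨ F.+-congˡ (F.trans (F.*-congʳ (F.*-comm _ _))
                                           (F.trans (F.*-assoc _ _ _) (F.trans (F.*-congˡ ωy≈1) (F.*-identityʳ _)))) ⟩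
    s F.+ (F.1# F.- s)          ≈⟨ x+[1-x]≈1 s ⟩
    F.1#                        ∎)
    where
    open ≈-Reasoning F.setoid
    s≉1 : ¬ s F.≈ F.1#
    s≉1 s≈1 = F.1≉0 (begin
      F.1#         ≈⟨ ωy≈1 ⟨
      ω s F.* y    ≈⟨ F.*-congʳ (F.*-congˡ (F.*-congˡ (F.0⁻¹≈0 (1-x≈0 s≈1)))) ⟩
      -1ᶠ F.* (s F.* F.0#) F.* y  ≈⟨ F.*-congʳ (F.trans (F.*-congˡ (F.zeroʳ s)) (F.zeroʳ _)) ⟩
      F.0# F.* y   ≈⟨ F.zeroˡ y ⟩
      F.0#         ∎)

  -- For s = 1/(1 - y) one has 1 - s = -s y, while ω(s) (1 - s) = -s; cancelling 1 - s, which is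
  -- nonzero as y ≠ 0, gives the claim.
  ω[1-y]⁻¹*y≈1 : ∀ {y} → ¬ y F.≈ F.0# → ¬ y F.≈ F.1# → ω ((F.1# F.- y) F.⁻¹) F.* y F.≈ F.1#
  ω[1-y]⁻¹*y≈1 {y} y≉0 y≉1 = F.*-cancelˡ-nonZero (1-x≉0 s≉1) (begin
    (F.1# F.- s) F.* (ω s F.* y)    ≈⟨ F.*-assoc _ _ _ ⟨
    (F.1# F.- s) F.* ω s F.* y      ≈⟨ F.*-congʳ (F.trans (F.*-comm _ _) (ω*[1-t]≈-t s≉1)) ⟩
    F.- s F.* y                     ≈⟨ 1-s≈-sy ⟨
    F.1# F.- s                      ≈⟨ F.*-identityʳ _ ⟨
    (F.1# F.- s) F.* F.1#           ∎)
    where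
    open ≈-Reasoning F.setoid
    s = (F.1# F.- y) F.⁻¹
    1-s≈-sy : F.1# F.- s F.≈ F.- s F.* y
    1-s≈-sy = begin
      F.1# F.- s                       ≈⟨ F.+-congʳ (⁻¹-inverseˡ (1-x≉0 y≉1)) ⟨
      s F.* (F.1# F.- y) F.- s         ≈⟨ F.+-congʳ (s[1-y]≈s-sy s y) ⟩
      s F.- s F.* y F.- s              ≈⟨ xyx⁻¹≈y s _ ⟩
      F.- (s F.* y)                    ≈⟨ -‿distribˡ-* s y ⟩
      F.- s F.* y                      ∎
    s≉1 : ¬ s F.≈ F.1#
    s≉1 s≈1 = F.*-nonZero (⁻¹-nonZero (1-x≉0 y≉1)) y≉0 (begin
      s F.* y                  ≈⟨ -‿involutive _ ⟨
      F.- F.- (s F.* y)        ≈⟨ F.-‿cong (F.trans (-‿distribˡ-* s y) (F.trans (F.sym 1-s≈-sy) (1-x≈0 s≈1))) ⟩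
      F.- F.0#                 ≈⟨ -0#≈0# ⟩
      F.0#                     ∎)

  -- By orthogonality only the solution s = 1/(1 - y) of ω(s) y = 1 contributes, with average 1. At
  -- y = 0 the left side would be 0 and the right side 1.
  binomial-theorem : ∀ A {y} → ¬ y F.≈ F.0# → ₁F₀ A y ≈ ⟦ A ⁻ ⟧ (F.1# F.- y)
  binomial-theorem A {y} y≉0 = K.trans (₁F₀-mean A y) (K.trans
    (∑F.∑-single {φ = λ s → ⟦ A ⟧ s * average (ω s F.* y)}
      (λ s≈t → K.*-cong (Character.⟦⟧-cong A s≈t) (K.*-congˡ (∑ᶜ-cong λ χ → Character.⟦⟧-cong χ (F.*-congʳ (ω-cong s≈t)))))
      ((F.1# F.- y) F.⁻¹)
      λ s s≉s₀ → *-zeroʳ (average-≉1 λ ωy≈1 → s≉s₀ (ω*y≈1⇒s≈[1-y]⁻¹ ωy≈1)))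
    at-[1-y]⁻¹)
    where
    average : F.Carrier → K.Carrier
    average g = mean λ χ → ⟦ χ ⟧ g
    -- The value of `A` at the inverse of 1 - y is by definition that of `A ⁻` at 1 - y.
    at-[1-y]⁻¹ : ⟦ A ⁻ ⟧ (F.1# F.- y) * average (ω ((F.1# F.- y) F.⁻¹) F.* y) ≈ ⟦ A ⁻ ⟧ (F.1# F.- y)
    at-[1-y]⁻¹ with y F.≟ F.1#
    -- For y = 1 the selected point is the default inverse of 0, and both sides vanish there.
    ... | yes y≈1 = K.trans (*-zeroˡ A⁻≈0) (K.sym A⁻≈0)
      where
      A⁻≈0 : ⟦ A ⁻ ⟧ (F.1# F.- y) ≈ 0#
      A⁻≈0 = χ-0 (A ⁻) (1-x≈0 y≈1)
    ... | no  y≉1 = K.trans (K.*-congˡ (average-1 (ω[1-y]⁻¹*y≈1 y≉0 y≉1))) (K.*-identityʳ _)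

-- Reduction of the Appell series to a ₃F₂.

module AppellReduction {c ℓ₁ ℓ₂ d m₁ m₂ : Level} {q : ℕ}
  (F : FiniteField c ℓ₁ ℓ₂ q) (K : AlgebraicallyClosedField₀ d m₁ m₂) where
  open Characters F K
  open FieldInverse F
  open Orthogonality F K
  open HypergeometricSums F K
  open K using (_+_; _*_; 0#; 1#; _≈_)
  open MonoidSolver K.*-commutativeMonoid using (solve; _⊕_; _⊜_)
  open RingProperties F.ring using (-0#≈0#; -‿distribˡ-*; -‿distribʳ-*; -‿involutive; [y-z]x≈yx-zx)

  -- Only the second and third binomials are expanded. Their χ-dependent parts χ(ω(t)) and χ(ω(w))
  -- join χ(z), so what remains to be averaged, with the first binomial, is a `₁F₀`.
  ₃F₂-∑∑ : ∀ A P₁ P₂ Q₁ Q₂ z → ₃F₂ A P₁ P₂ Q₁ Q₂ z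
    ≈ ∑ᶠ[ t ] ∑ᶠ[ w ] (weight P₁ Q₁ t * weight P₂ Q₂ w * ₁F₀ A (ω t F.* ω w F.* z))
  ₃F₂-∑∑ A P₁ P₂ Q₁ Q₂ z = begin
    mean (λ χ → binomial (A · χ) χ * binomial (P₁ · χ) (Q₁ · χ) * binomial (P₂ · χ) (Q₂ · χ) * ⟦ χ ⟧ z)
      ≈⟨ mean-cong _ _ expand ⟩
    mean (λ χ → ∑ᶠ[ t ] ∑ᶠ[ w ] term χ t w)
      ≈⟨ mean-∑ᶠ (λ χ t → ∑ᶠ[ w ] term χ t w) ⟩
    ∑ᶠ[ t ] mean (λ χ → ∑ᶠ[ w ] term χ t w)
      ≈⟨ ∑ᶠ-cong (λ t → mean-∑ᶠ (λ χ w → term χ t w)) ⟩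
    ∑ᶠ[ t ] ∑ᶠ[ w ] mean (λ χ → term χ t w)
      ≈⟨ ∑ᶠ-cong (λ t → ∑ᶠ-cong λ w → mean-*ˡ (weight P₁ Q₁ t * weight P₂ Q₂ w)
           λ χ → binomial (A · χ) χ * ⟦ χ ⟧ (ω t F.* ω w F.* z)) ⟩
    ∑ᶠ[ t ] ∑ᶠ[ w ] (weight P₁ Q₁ t * weight P₂ Q₂ w * ₁F₀ A (ω t F.* ω w F.* z)) ∎
    where
    open ≈-Reasoning K.setoid
    term : Character → F.Carrier → F.Carrier → K.Carrier
    term χ t w = weight P₁ Q₁ t * weight P₂ Q₂ w * (binomial (A · χ) χ * ⟦ χ ⟧ (ω t F.* ω w F.* z))
    expand : ∀ χ → binomial (A · χ) χ * binomial (P₁ · χ) (Q₁ · χ) * binomial (P₂ · χ) (Q₂ · χ) * ⟦ χ ⟧ z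
      ≈ ∑ᶠ[ t ] ∑ᶠ[ w ] term χ t w
    expand χ = begin
      b₀ * binomial (P₁ · χ) (Q₁ · χ) * binomial (P₂ · χ) (Q₂ · χ) * ⟦ χ ⟧ z
        ≈⟨ solve 4 (λ b₀ b₁ b₂ e → ((b₀ ⊕ b₁) ⊕ b₂) ⊕ e ⊜ b₁ ⊕ (b₂ ⊕ (b₀ ⊕ e))) K.refl _ _ _ _ ⟩
      binomial (P₁ · χ) (Q₁ · χ) * (binomial (P₂ · χ) (Q₂ · χ) * X)
        ≈⟨ K.*-cong (binomial-·χ-·χ P₁ Q₁ χ) (K.*-congʳ (binomial-·χ-·χ P₂ Q₂ χ)) ⟩
      ∑ᶠ f * (∑ᶠ g * X)
        ≈⟨ *-distribʳ-∑ᶠ (∑ᶠ g * X) f ⟩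
      ∑ᶠ[ t ] (f t * (∑ᶠ g * X))
        ≈⟨ ∑ᶠ-cong (λ t → K.trans (K.*-congˡ (*-distribʳ-∑ᶠ X g)) (*-distribˡ-∑ᶠ (f t) λ w → g w * X)) ⟩
      ∑ᶠ[ t ] ∑ᶠ[ w ] (f t * (g w * X))
        ≈⟨ ∑ᶠ-cong (λ t → ∑ᶠ-cong λ w → collect t w) ⟩
      ∑ᶠ[ t ] ∑ᶠ[ w ] term χ t w ∎
      where
      b₀ = binomial (A · χ) χ
      X = b₀ * ⟦ χ ⟧ z
      f g : F.Carrier → K.Carrier
      f t = weight P₁ Q₁ t * ⟦ χ ⟧ (ω t)
      g w = weight P₂ Q₂ w * ⟦ χ ⟧ (ω w)
      collect : ∀ t w → f t * (g w * X) ≈ term χ t w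
      collect t w = begin
        weight P₁ Q₁ t * ⟦ χ ⟧ (ω t) * (weight P₂ Q₂ w * ⟦ χ ⟧ (ω w) * (b₀ * ⟦ χ ⟧ z))
          ≈⟨ solve 6 (λ p s q t b e → (p ⊕ s) ⊕ ((q ⊕ t) ⊕ (b ⊕ e)) ⊜ (p ⊕ q) ⊕ (b ⊕ ((s ⊕ t) ⊕ e))) K.refl
               (weight P₁ Q₁ t) (⟦ χ ⟧ (ω t)) (weight P₂ Q₂ w) (⟦ χ ⟧ (ω w)) b₀ (⟦ χ ⟧ z) ⟩
        weight P₁ Q₁ t * weight P₂ Q₂ w * (b₀ * (⟦ χ ⟧ (ω t) * ⟦ χ ⟧ (ω w) * ⟦ χ ⟧ z))
          ≈⟨ K.*-congˡ (K.*-congˡ (K.trans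
               (K.*-congʳ (K.sym (Character.*-homo χ (ω t) (ω w)))) (K.sym (Character.*-homo χ (ω t F.* ω w) z)))) ⟩
        term χ t w ∎

  -- Replacing the constant 1 by x + (1 - x) leaves an expression in 1 - u and 1 - v alone. This is
  -- where the second argument 1 - x matters.
  affine : ∀ u v x → F.1# F.- u F.* x F.- v F.* (F.1# F.- x) F.≈ (F.1# F.- u) F.* x F.+ (F.1# F.- v) F.* (F.1# F.- x)
  affine u v x = F.sym (begin
    (F.1# F.- u) F.* x F.+ (F.1# F.- v) F.* x′
      ≈⟨ F.+-cong ([y-z]x≈yx-zx x F.1# u) ([y-z]x≈yx-zx x′ F.1# v) ⟩
    (F.1# F.* x F.- u F.* x) F.+ (F.1# F.* x′ F.- v F.* x′)
      ≈⟨ F.+-cong (F.+-congʳ (F.*-identityˡ x)) (F.+-congʳ (F.*-identityˡ x′)) ⟩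
    (x F.- u F.* x) F.+ (x′ F.- v F.* x′)
      ≈⟨ interchange x (F.- (u F.* x)) x′ (F.- (v F.* x′)) ⟩
    (x F.+ x′) F.- u F.* x F.- v F.* x′
      ≈⟨ F.+-congʳ (F.+-congʳ (x+[1-x]≈1 x)) ⟩
    F.1# F.- u F.* x F.- v F.* x′ ∎)
    where
    open ≈-Reasoning F.setoid
    open MonoidSolver F.+-commutativeMonoid using () renaming (solve to solve⁺; _⊕_ to _⊞_; _⊜_ to _⊜⁺_)
    x′ = F.1# F.- x
    interchange : ∀ a b c d → (a F.+ b) F.+ (c F.+ d) F.≈ ((a F.+ c) F.+ b) F.+ d
    interchange = solve⁺ 4 (λ a b c d → (a ⊞ b) ⊞ (c ⊞ d) ⊜⁺ ((a ⊞ c) ⊞ b) ⊞ d) F.refl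

  -- Used with p = ω(t), which is 1 - u, and s = ω(w), whose inverse is 1 - v. It isolates the
  -- factor 1 - y to which the binomial theorem applies.
  factor : ∀ {p s x} → ¬ s F.≈ F.0# → ¬ x F.≈ F.1# →
    p F.* x F.+ s F.⁻¹ F.* (F.1# F.- x)
      F.≈ s F.⁻¹ F.* (F.1# F.- x) F.* (F.1# F.- p F.* s F.* (F.- (x F./ (F.1# F.- x))))
  factor {p} {s} {x} s≉0 x≉1 = F.sym (begin
    s F.⁻¹ F.* x′ F.* (F.1# F.- p F.* s F.* (F.- (x F./ x′)))
      ≈⟨ F.*-congˡ (F.+-congˡ (F.trans (F.-‿cong (F.sym (-‿distribʳ-* (p F.* s) _))) (-‿involutive _))) ⟩
    s F.⁻¹ F.* x′ F.* (F.1# F.+ p F.* s F.* (x F./ x′))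
      ≈⟨ F.distribˡ _ _ _ ⟩
    s F.⁻¹ F.* x′ F.* F.1# F.+ s F.⁻¹ F.* x′ F.* (p F.* s F.* (x F./ x′))
      ≈⟨ F.+-cong (F.*-identityʳ _) (rearrange (s F.⁻¹) x′ p s x (x′ F.⁻¹)) ⟩
    s F.⁻¹ F.* x′ F.+ (s F.⁻¹ F.* s) F.* (x′ F.* x′ F.⁻¹) F.* (p F.* x)
      ≈⟨ F.+-congˡ (F.*-congʳ (F.*-cong (⁻¹-inverseˡ s≉0) (F.⁻¹-inverseʳ (1-x≉0 x≉1)))) ⟩
    s F.⁻¹ F.* x′ F.+ F.1# F.* F.1# F.* (p F.* x)
      ≈⟨ F.+-congˡ (F.trans (F.*-congʳ (F.*-identityˡ _)) (F.*-identityˡ _)) ⟩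
    s F.⁻¹ F.* x′ F.+ p F.* x
      ≈⟨ F.+-comm _ _ ⟩
    p F.* x F.+ s F.⁻¹ F.* x′ ∎)
    where
    open ≈-Reasoning F.setoid
    open MonoidSolver F.*-commutativeMonoid using () renaming (solve to solveF; _⊕_ to _⊠_; _⊜_ to _⊜F_)
    x′ = F.1# F.- x
    rearrange : ∀ s′ x′ p s x x″ → s′ F.* x′ F.* (p F.* s F.* (x F.* x″)) F.≈ (s′ F.* s) F.* (x′ F.* x″) F.* (p F.* x)
    rearrange = solveF 6 (λ s′ x′ p s x x″ → (s′ ⊠ x′) ⊠ ((p ⊠ s) ⊠ (x ⊠ x″)) ⊜F ((s′ ⊠ s) ⊠ (x′ ⊠ x″)) ⊠ (p ⊠ x)) F.refl

  χ-cong : ∀ χ {x y} → x F.≈ y → ⟦ χ ⟧ x ≈ ⟦ χ ⟧ y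
  χ-cong χ = Character.⟦⟧-cong χ

  χ-* : ∀ χ x y → ⟦ χ ⟧ (x F.* y) ≈ ⟦ χ ⟧ x * ⟦ χ ⟧ y
  χ-* χ = Character.*-homo χ

  χ-1² : ∀ χ → ⟦ χ ⟧ -1ᶠ * ⟦ χ ⟧ -1ᶠ ≈ 1#
  χ-1² χ = K.trans (K.sym (χ-* χ _ _)) (χ-1 χ -1*-1≈1)

  -- Expanding ω(t), the values of `B` at 1/(1 - t) cancel and the two signs B(-1) multiply to 1.
  factor-B : ∀ B {t} → ¬ t F.≈ F.1# →
    ⟦ B ⟧ -1ᶠ * (⟦ B ⟧ ((F.1# F.- t) F.⁻¹) * ⟦ B ⁻ ⟧ (ω t)) ≈ ⟦ B ⁻ ⟧ t
  factor-B B {t} t≉1 = begin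
    n * (⟦ B ⟧ u * ⟦ B ⁻ ⟧ (ω t))
      ≈⟨ K.*-congˡ (K.*-congˡ (χ-ω (B ⁻) t)) ⟩
    n * (⟦ B ⟧ u * (⟦ B ⟧ (-1ᶠ F.⁻¹) * (⟦ B ⁻ ⟧ t * ⟦ B ⁻ ⟧ u)))
      ≈⟨ K.*-congˡ (K.*-congˡ (K.*-congʳ (χ-cong B -1⁻¹≈-1))) ⟩
    n * (⟦ B ⟧ u * (n * (⟦ B ⁻ ⟧ t * ⟦ B ⁻ ⟧ u)))
      ≈⟨ solve 4 (λ n b b′ t → n ⊕ (b ⊕ (n ⊕ (t ⊕ b′))) ⊜ ((n ⊕ n) ⊕ (b′ ⊕ b)) ⊕ t) K.refl
           n (⟦ B ⟧ u) (⟦ B ⁻ ⟧ u) (⟦ B ⁻ ⟧ t) ⟩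
    n * n * (⟦ B ⁻ ⟧ u * ⟦ B ⟧ u) * ⟦ B ⁻ ⟧ t
      ≈⟨ K.*-congʳ (K.*-cong (χ-1² B) (χ⁻-inverseˡ B (⁻¹-nonZero (1-x≉0 t≉1)))) ⟩
    1# * 1# * ⟦ B ⁻ ⟧ t
      ≈⟨ K.trans (K.*-congʳ (K.*-identityˡ _)) (K.*-identityˡ _) ⟩
    ⟦ B ⁻ ⟧ t ∎
    where
    open ≈-Reasoning K.setoid
    n = ⟦ B ⟧ -1ᶠ
    u = (F.1# F.- t) F.⁻¹

  χ⁻-ω⁻¹ : ∀ χ w → ⟦ χ ⁻ ⟧ (ω w F.⁻¹) ≈ ⟦ χ ⟧ -1ᶠ * (⟦ χ ⟧ w * ⟦ χ ⁻ ⟧ (F.1# F.- w))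
  χ⁻-ω⁻¹ χ w = K.trans (χ-cong χ (⁻¹-involutive (ω w))) (χ-ω χ w)

  -- Here the values at w cancel, and the sign χ(-1) from ω(w) survives.
  factor-B′ : ∀ χ {w} → ¬ w F.≈ F.0# →
    ⟦ χ ⟧ (w F.⁻¹) * ⟦ χ ⁻ ⟧ (ω w F.⁻¹) ≈ ⟦ χ ⟧ -1ᶠ * ⟦ χ ⁻ ⟧ (F.1# F.- w)
  factor-B′ χ {w} w≉0 = begin
    ⟦ χ ⁻ ⟧ w * ⟦ χ ⁻ ⟧ (ω w F.⁻¹)
      ≈⟨ K.*-congˡ (χ⁻-ω⁻¹ χ w) ⟩
    ⟦ χ ⁻ ⟧ w * (n * (⟦ χ ⟧ w * ⟦ χ ⁻ ⟧ (F.1# F.- w)))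
      ≈⟨ solve 4 (λ w′ n w x → w′ ⊕ (n ⊕ (w ⊕ x)) ⊜ (w′ ⊕ w) ⊕ (n ⊕ x)) K.refl
           (⟦ χ ⁻ ⟧ w) n (⟦ χ ⟧ w) (⟦ χ ⁻ ⟧ (F.1# F.- w)) ⟩
    ⟦ χ ⁻ ⟧ w * ⟦ χ ⟧ w * (n * ⟦ χ ⁻ ⟧ (F.1# F.- w))
      ≈⟨ K.trans (K.*-congʳ (χ⁻-inverseˡ χ w≉0)) (K.*-identityˡ _) ⟩
    n * ⟦ χ ⁻ ⟧ (F.1# F.- w) ∎
    where
    open ≈-Reasoning K.setoid
    n = ⟦ χ ⟧ -1ᶠ

  -- A value at an inverse is by definition a value of the inverse character. The double inverse is
  -- kept because it occurs in this form in the weight with lower character `Q₂`.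
  factor-C′ : ∀ χ w → ⟦ χ ⟧ (ω w F.⁻¹) ≈ ⟦ χ ⁻ ⟧ -1ᶠ * (⟦ χ ⁻ ⟧ w * ⟦ (χ ⁻) ⁻ ⟧ (F.1# F.- w))
  factor-C′ χ w = χ-ω (χ ⁻) w

  factor-A : ∀ χ w x y → ⟦ χ ⁻ ⟧ (ω w F.⁻¹ F.* (F.1# F.- x) F.* (F.1# F.- y))
    ≈ ⟦ χ ⟧ -1ᶠ * (⟦ χ ⟧ w * ⟦ χ ⁻ ⟧ (F.1# F.- w)) * ⟦ χ ⁻ ⟧ (F.1# F.- x) * ⟦ χ ⁻ ⟧ (F.1# F.- y)
  factor-A χ w x y = K.trans (χ-* (χ ⁻) _ _) (K.*-congʳ (K.trans (χ-* (χ ⁻) _ _) (K.*-congʳ (χ⁻-ω⁻¹ χ w))))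

  module _ (A B B′ C C′ : Character) {x : F.Carrier} (x≉0 : ¬ x F.≈ F.0#) (x≉1 : ¬ x F.≈ F.1#) where
    private
      z = F.- (x F./ (F.1# F.- x))
      k₁ = ⟦ B · B′ · C · C′ ⟧ -1ᶠ
      k₂ = ⟦ C · B′ · C′ ⟧ -1ᶠ * ⟦ A ⁻ ⟧ (F.1# F.- x)
      P₂ = A · C′ ⁻
      Q₂ = A · B′ · C′ ⁻

    summand : F.Carrier → F.Carrier → K.Carrier
    summand u v = ⟦ B ⟧ u * ⟦ B′ ⟧ v * ⟦ B ⁻ · C ⟧ (F.1# F.- u) * ⟦ B′ ⁻ · C′ ⟧ (F.1# F.- v)
      * ⟦ A ⁻ ⟧ (F.1# F.- u F.* x F.- v F.* (F.1# F.- x))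

    summand-cong : ∀ {u u′ v v′} → u F.≈ u′ → v F.≈ v′ → summand u v ≈ summand u′ v′
    summand-cong u≈u′ v≈v′ = K.*-cong (K.*-cong (K.*-cong (K.*-cong (χ-cong B u≈u′) (χ-cong B′ v≈v′))
      (χ-cong (B ⁻ · C) (1-x-cong u≈u′))) (χ-cong (B′ ⁻ · C′) (1-x-cong v≈v′)))
      (χ-cong (A ⁻) (F.+-cong (1-x-cong (F.*-congʳ u≈u′)) (F.-‿cong (F.*-congʳ v≈v′))))

    summand-u≈0 : ∀ {u v} → u F.≈ F.0# → summand u v ≈ 0#
    summand-u≈0 u≈0 = *-zeroˡ (*-zeroˡ (*-zeroˡ (*-zeroˡ (χ-0 B u≈0))))

    summand-v≈0 : ∀ {u v} → v F.≈ F.0# → summand u v ≈ 0#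
    summand-v≈0 v≈0 = *-zeroˡ (*-zeroˡ (*-zeroˡ (*-zeroʳ (χ-0 B′ v≈0))))

    summand-u≈1 : ∀ {u v} → u F.≈ F.1# → summand u v ≈ 0#
    summand-u≈1 u≈1 = *-zeroˡ (*-zeroˡ (*-zeroʳ (χ-0 (B ⁻ · C) (1-x≈0 u≈1))))

    summand-v≈1 : ∀ {u v} → v F.≈ F.1# → summand u v ≈ 0#
    summand-v≈1 v≈1 = *-zeroˡ (*-zeroʳ (χ-0 (B′ ⁻ · C′) (1-x≈0 v≈1)))

    z≉0 : ¬ z F.≈ F.0#
    z≉0 z≈0 = F.*-nonZero x≉0 (⁻¹-nonZero (1-x≉0 x≉1)) (begin
      x F./ (F.1# F.- x)   ≈⟨ -‿involutive _ ⟨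
      F.- z                ≈⟨ F.-‿cong z≈0 ⟩
      F.- F.0#             ≈⟨ -0#≈0# ⟩
      F.0#                 ∎)
      where open ≈-Reasoning F.setoid

    term : F.Carrier → F.Carrier → K.Carrier
    term t w = weight (B ⁻ · C) C t * weight P₂ Q₂ w * ₁F₀ A (ω t F.* ω w F.* z)

    -- Away from 0 and 1 all inverses are genuine, and the substitution can be carried out one
    -- character at a time.
    term-nonDegenerate : ∀ {t w} → ¬ t F.≈ F.0# → ¬ t F.≈ F.1# → ¬ w F.≈ F.0# → ¬ w F.≈ F.1# →
      k₁ * summand ((F.1# F.- t) F.⁻¹) (w F.⁻¹) ≈ k₂ * term t w
    term-nonDegenerate {t} {w} t≉0 t≉1 w≉0 w≉1 = begin
      nB * nB′ * nC * nC′ * (⟦ B ⟧ u * ⟦ B′ ⟧ v * ⟦ B ⁻ · C ⟧ (F.1# F.- u) * ⟦ B′ ⁻ · C′ ⟧ (F.1# F.- v)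
        * ⟦ A ⁻ ⟧ (F.1# F.- u F.* x F.- v F.* (F.1# F.- x)))
        ≈⟨ K.*-congˡ (K.*-cong (K.*-cong (K.*-congˡ (χ-cong (B ⁻ · C) (1-[1-t]⁻¹≈ω t≉1)))
             (χ-cong (B′ ⁻ · C′) (1-w⁻¹≈ω⁻¹ w≉0 w≉1))) (χ-cong (A ⁻) argument)) ⟩
      nB * nB′ * nC * nC′ * (⟦ B ⟧ u * ⟦ B′ ⟧ v * (⟦ B ⁻ ⟧ p * ⟦ C ⟧ p) * (⟦ B′ ⁻ ⟧ s′ * ⟦ C′ ⟧ s′)
        * ⟦ A ⁻ ⟧ (s′ F.* (F.1# F.- x) F.* (F.1# F.- y)))
        ≈⟨ solve 11 (λ nB nB′ nC nC′ Bu B′v Bp Cp B′s C′s a →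
             (((nB ⊕ nB′) ⊕ nC) ⊕ nC′) ⊕ ((((Bu ⊕ B′v) ⊕ (Bp ⊕ Cp)) ⊕ (B′s ⊕ C′s)) ⊕ a)
             ⊜ (((nB ⊕ (Bu ⊕ Bp)) ⊕ (nC ⊕ Cp)) ⊕ ((nB′ ⊕ (B′v ⊕ B′s)) ⊕ (nC′ ⊕ C′s))) ⊕ a) K.refl
             nB nB′ nC nC′ (⟦ B ⟧ u) (⟦ B′ ⟧ v) (⟦ B ⁻ ⟧ p) (⟦ C ⟧ p) (⟦ B′ ⁻ ⟧ s′) (⟦ C′ ⟧ s′) _ ⟩
      nB * (⟦ B ⟧ u * ⟦ B ⁻ ⟧ p) * (nC * ⟦ C ⟧ p) * (nB′ * (⟦ B′ ⟧ v * ⟦ B′ ⁻ ⟧ s′) * (nC′ * ⟦ C′ ⟧ s′))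
        * ⟦ A ⁻ ⟧ (s′ F.* (F.1# F.- x) F.* (F.1# F.- y))
        ≈⟨ K.*-cong (K.*-cong (K.*-cong (factor-B B t≉1) (K.*-congˡ (χ-ω C t)))
             (K.*-cong (K.*-congˡ (factor-B′ B′ w≉0)) (K.*-congˡ (factor-C′ C′ w)))) (factor-A A w x y) ⟩
      ⟦ B ⁻ ⟧ t * (nC * (nC * (⟦ C ⟧ t * ⟦ C ⁻ ⟧ (F.1# F.- t))))
        * (nB′ * (nB′ * ⟦ B′ ⁻ ⟧ (F.1# F.- w)) * (nC′ * (⟦ C′ ⁻ ⟧ -1ᶠ * (⟦ C′ ⁻ ⟧ w * ⟦ (C′ ⁻) ⁻ ⟧ (F.1# F.- w)))))
        * (nA * (⟦ A ⟧ w * ⟦ A ⁻ ⟧ (F.1# F.- w)) * ⟦ A ⁻ ⟧ (F.1# F.- x) * ⟦ A ⁻ ⟧ (F.1# F.- y))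
        -- One sign each of C, B′ and C′ goes into `k₂`. The remaining signs are C(-1) and `Q₂` at
        -- -1, as the two weights require.
        ≈⟨ solve 15 (λ Bt nC Ct C1t nB′ B′1w nC′ nC′⁻ C′w C′1w nA Aw A1w A1x A1y →
             ((Bt ⊕ (nC ⊕ (nC ⊕ (Ct ⊕ C1t)))) ⊕ ((nB′ ⊕ (nB′ ⊕ B′1w)) ⊕ (nC′ ⊕ (nC′⁻ ⊕ (C′w ⊕ C′1w)))))
               ⊕ (((nA ⊕ (Aw ⊕ A1w)) ⊕ A1x) ⊕ A1y)
             ⊜ (((nC ⊕ nB′) ⊕ nC′) ⊕ A1x) ⊕ (((nC ⊕ ((Bt ⊕ Ct) ⊕ C1t))
               ⊕ (((nA ⊕ nB′) ⊕ nC′⁻) ⊕ ((Aw ⊕ C′w) ⊕ ((A1w ⊕ B′1w) ⊕ C′1w)))) ⊕ A1y)) K.refl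
             (⟦ B ⁻ ⟧ t) nC (⟦ C ⟧ t) (⟦ C ⁻ ⟧ (F.1# F.- t)) nB′ (⟦ B′ ⁻ ⟧ (F.1# F.- w)) nC′ (⟦ C′ ⁻ ⟧ -1ᶠ)
             (⟦ C′ ⁻ ⟧ w) (⟦ (C′ ⁻) ⁻ ⟧ (F.1# F.- w)) nA (⟦ A ⟧ w) (⟦ A ⁻ ⟧ (F.1# F.- w))
             (⟦ A ⁻ ⟧ (F.1# F.- x)) (⟦ A ⁻ ⟧ (F.1# F.- y)) ⟩
      k₂ * (weight (B ⁻ · C) C t * weight P₂ Q₂ w * ⟦ A ⁻ ⟧ (F.1# F.- y))
        -- The binomial theorem read backwards, allowed because y is a product of nonzero factors.
        ≈⟨ K.*-congˡ (K.*-congˡ (binomial-theorem A y≉0)) ⟨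
      k₂ * term t w ∎
      where
      open ≈-Reasoning K.setoid
      nA = ⟦ A ⟧ -1ᶠ
      nB = ⟦ B ⟧ -1ᶠ
      nB′ = ⟦ B′ ⟧ -1ᶠ
      nC = ⟦ C ⟧ -1ᶠ
      nC′ = ⟦ C′ ⟧ -1ᶠ
      u = (F.1# F.- t) F.⁻¹
      v = w F.⁻¹
      p = ω t
      s′ = ω w F.⁻¹
      y = ω t F.* ω w F.* z
      y≉0 : ¬ y F.≈ F.0#
      y≉0 = F.*-nonZero (F.*-nonZero (ω-nonZero t≉0 t≉1) (ω-nonZero w≉0 w≉1)) z≉0
      argument : F.1# F.- u F.* x F.- v F.* (F.1# F.- x) F.≈ s′ F.* (F.1# F.- x) F.* (F.1# F.- y)
      argument = F.trans (affine u v x) (F.trans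
        (F.+-cong (F.*-congʳ (1-[1-t]⁻¹≈ω t≉1)) (F.*-congʳ (1-w⁻¹≈ω⁻¹ w≉0 w≉1)))
        (factor (ω-nonZero w≉0 w≉1) x≉1))

    -- If t or w is 0 or 1, then u or v is 0 or 1, with 1/0 read as 0. A character is then evaluated
    -- at 0 on both sides, so no boundary terms arise.
    term≈ : ∀ t w → k₁ * summand ((F.1# F.- t) F.⁻¹) (w F.⁻¹) ≈ k₂ * term t w
    term≈ t w with t F.≟ F.0# | t F.≟ F.1# | w F.≟ F.0# | w F.≟ F.1#
    ... | no t≉0  | no t≉1  | no w≉0  | no w≉1  = term-nonDegenerate t≉0 t≉1 w≉0 w≉1
    ... | yes t≈0 | _       | _       | _       = K.trans
      (*-zeroʳ (summand-u≈1 (F.trans (F.⁻¹-cong (1-x≈1 t≈0)) F.1⁻¹≈1)))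
      (K.sym (*-zeroʳ (*-zeroˡ (*-zeroˡ (weight-0 (B ⁻ · C) C t≈0)))))
    ... | no _    | yes t≈1 | _       | _       = K.trans
      (*-zeroʳ (summand-u≈0 (F.0⁻¹≈0 (1-x≈0 t≈1))))
      (K.sym (*-zeroʳ (*-zeroˡ (*-zeroˡ (weight-1 (B ⁻ · C) C t≈1)))))
    ... | no _    | no _    | yes w≈0 | _       = K.trans
      (*-zeroʳ (summand-v≈0 (F.0⁻¹≈0 w≈0)))
      (K.sym (*-zeroʳ (*-zeroˡ (*-zeroʳ (weight-0 P₂ Q₂ w≈0)))))
    ... | no _    | no _    | no _    | yes w≈1 = K.trans
      (*-zeroʳ (summand-v≈1 (F.trans (F.⁻¹-cong w≈1) F.1⁻¹≈1)))
      (K.sym (*-zeroʳ (*-zeroˡ (*-zeroʳ (weight-1 P₂ Q₂ w≈1)))))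

    F₂-nonZero : F₂ A B B′ C C′ x (F.1# F.- x) ≈ k₂ * ₃F₂ A (B ⁻ · C) P₂ C Q₂ z
    F₂-nonZero = begin
      ⟦ ε ⟧ (x F.* (F.1# F.- x)) * k₁ * ∑ᶠ[ u ] ∑ᶠ[ v ] summand u v
        ≈⟨ K.*-congʳ (K.trans (K.*-congʳ (ε-≉0 (F.*-nonZero x≉0 (1-x≉0 x≉1)))) (K.*-identityˡ _)) ⟩
      k₁ * ∑ᶠ[ u ] ∑ᶠ[ v ] summand u v
        -- The substitution u = 1/(1 - t), a composite of two permutations of the field.
        ≈⟨ K.*-congˡ (∑F.∑-reindex {φ = λ u → ∑ᶠ[ v ] summand u v} (λ u≈u′ → ∑ᶠ-cong λ v → summand-cong {v = v} u≈u′ F.refl)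
             (Composition.inverse 1-x-inverse ⁻¹-inverse)) ⟩
      k₁ * ∑ᶠ[ t ] ∑ᶠ[ v ] summand ((F.1# F.- t) F.⁻¹) v
        ≈⟨ K.*-congˡ (∑ᶠ-cong λ t → ∑F.∑-reindex {φ = λ v → summand ((F.1# F.- t) F.⁻¹) v} (summand-cong F.refl) ⁻¹-inverse) ⟩
      k₁ * ∑ᶠ[ t ] ∑ᶠ[ w ] summand ((F.1# F.- t) F.⁻¹) (w F.⁻¹)
        ≈⟨ *-distribˡ-∑∑ᶠ k₁ (λ t w → summand ((F.1# F.- t) F.⁻¹) (w F.⁻¹)) ⟩
      ∑ᶠ[ t ] ∑ᶠ[ w ] (k₁ * summand ((F.1# F.- t) F.⁻¹) (w F.⁻¹))
        ≈⟨ ∑ᶠ-cong (λ t → ∑ᶠ-cong λ w → term≈ t w) ⟩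
      ∑ᶠ[ t ] ∑ᶠ[ w ] (k₂ * term t w)
        ≈⟨ *-distribˡ-∑∑ᶠ k₂ term ⟨
      k₂ * ∑ᶠ[ t ] ∑ᶠ[ w ] term t w
        ≈⟨ K.*-congˡ (₃F₂-∑∑ A (B ⁻ · C) P₂ C Q₂ z) ⟨
      k₂ * ₃F₂ A (B ⁻ · C) P₂ C Q₂ z ∎
      where
      open ≈-Reasoning K.setoid
      *-distribˡ-∑∑ᶠ : ∀ k (φ : F.Carrier → F.Carrier → K.Carrier) → k * ∑ᶠ[ t ] ∑ᶠ[ w ] φ t w ≈ ∑ᶠ[ t ] ∑ᶠ[ w ] (k * φ t w)
      *-distribˡ-∑∑ᶠ k φ = K.trans (*-distribˡ-∑ᶠ k λ t → ∑ᶠ[ w ] φ t w) (∑ᶠ-cong λ t → *-distribˡ-∑ᶠ k (φ t))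

  ₃F₂-0 : ∀ A₀ A₁ A₂ B₁ B₂ {z} → z F.≈ F.0# → ₃F₂ A₀ A₁ A₂ B₁ B₂ z ≈ 0#
  ₃F₂-0 A₀ A₁ A₂ B₁ B₂ z≈0 = *-zeroʳ (∑ᶜ-0 λ χ →
    *-zeroʳ {binomial (A₀ · χ) χ * binomial (A₁ · χ) (B₁ · χ) * binomial (A₂ · χ) (B₂ · χ)} (χ-0 χ z≈0))

  F₂-0 : ∀ A B B′ C C′ {x y} → x F.≈ F.0# → F₂ A B B′ C C′ x y ≈ 0#
  F₂-0 A B B′ C C′ x≈0 = *-zeroˡ (*-zeroˡ (χ-0 ε (F.trans (F.*-congʳ x≈0) (F.zeroˡ _))))

  F₂-reduction : ∀ A B B′ C C′ x → ¬ x F.≈ F.1# →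
    F₂ A B B′ C C′ x (F.1# F.- x)
      ≈ ⟦ C · B′ · C′ ⟧ (F.- F.1#) * ⟦ A ⁻ ⟧ (F.1# F.- x)
          * ₃F₂ A (B ⁻ · C) (A · C′ ⁻) C (A · B′ · C′ ⁻) (F.- (x F./ (F.1# F.- x)))
  F₂-reduction A B B′ C C′ x x≉1 with x F.≟ F.0#
  ... | no  x≉0 = F₂-nonZero A B B′ C C′ x≉0 x≉1
  -- At x = 0 the left side vanishes through ε(x(1 - x)), the right side because every χ is
  -- evaluated at 0.
  ... | yes x≈0 = K.trans (F₂-0 A B B′ C C′ x≈0) (K.sym (*-zeroʳ (₃F₂-0 A (B ⁻ · C) (A · C′ ⁻) C (A · B′ · C′ ⁻) z≈0)))
    where
    z≈0 : F.- (x F./ (F.1# F.- x)) F.≈ F.0#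
    z≈0 = F.trans (-‿distribˡ-* x _) (F.trans (F.*-congʳ (F.trans (F.-‿cong x≈0) -0#≈0#)) (F.zeroˡ _))

theorem3p5 : ∀ {c ℓ₁ ℓ₂ d m₁ m₂} {p k : ℕ} → Prime p →
    (F : FiniteField c ℓ₁ ℓ₂ (p ^ k)) (K : AlgebraicallyClosedField₀ d m₁ m₂) →
    let open Characters F K in
    (A B B′ C C′ : Character) (x : F.Carrier) → ¬ x F.≈ F.1# →
    F₂ A B B′ C C′ x (F.1# F.- x)
    K.≈ ⟦ C · B′ · C′ ⟧ (F.- F.1#) K.* ⟦ A ⁻ ⟧ (F.1# F.- x)
    K.* ₃F₂ A (B ⁻ · C) (A · C′ ⁻) C (A · B′ · C′ ⁻) (F.- (x F./ (F.1# F.- x)))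
theorem3p5 _ F K = AppellReduction.F₂-reduction F K
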